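{- Let $q>2$ be a power of $2$ and let $U$ be an intersecting family of $q^2-\varepsilon$ polynomials over $\mathbb{F}_q$ of degree at most $2$, where $\varepsilon<\frac{q\sqrt{q}}{4}-\frac{q}{8}-\frac{\sqrt{q}}{8}$. Then the graphs of the polynomials in $U$ share a common point.
   Context: The graph of $f\colon\mathbb{F}_q\to\mathbb{F}_q$ is $\{(x,f(x)):x\in\mathbb{F}_q\}$. A set of polynomials over $\mathbb{F}_q$ is intersecting if the graphs of any two of its members share at least one point. -}

module Defs where

open import Algebra.Apartness.Bundles using (HeytingField; module HeytingField)
open import Data.Fin using (Fin)
open import Data.Integer using (ℤ; +_)
open import Data.List using (List)
open import Data.Nat using (ℕ; suc)
open import Data.Product using (_×_; _,_; ∃-syntax)
open import Data.Rational.Unnormalised using (ℚᵘ; 0ℚᵘ; _/_; _-_; _*_; _≤_; _<_)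
open import Data.Vec using (Vec; []; _∷_)
open import Function.Bundles using (Inverse)
open import Level using (Level; _⊔_)
open import Relation.Binary.Bundles using (Setoid)
open import Relation.Binary.PropositionalEquality using (setoid)
open import Relation.Unary using (Pred)
import Data.List.Membership.Setoid as Membership
import Data.List.Relation.Unary.Unique.Setoid as UniqueSetoid
import Data.Vec.Relation.Binary.Equality.Setoid as VecEquality

-- Equality on an enumerated Heyting field is decidable, so x # y and ¬ x ≈ y
-- agree there: a Heyting field of cardinality q is a field with q elements in
-- the ordinary sense.
HasCardinality : ∀ {c ℓ₁ ℓ₂} → HeytingField c ℓ₁ ℓ₂ → ℕ → Set (c ⊔ ℓ₁)
HasCardinality F q = Inverse (HeytingField.setoid F) (setoid (Fin q))

module Polynomials {c ℓ₁ ℓ₂ : Level} (F : HeytingField c ℓ₁ ℓ₂) where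

  private module F = HeytingField F

  -- Coefficient vectors, constant term first.  The leading entries may vanish,
  -- so these are the polynomials of degree at most d, including zero.
  Poly≤ : ℕ → Set c
  Poly≤ d = Vec F.Carrier (suc d)

  poly≤-setoid : ℕ → Setoid c (c ⊔ ℓ₁)
  poly≤-setoid d = VecEquality.≋-setoid F.setoid (suc d)

  eval : ∀ {n} → Vec F.Carrier n → F.Carrier → F.Carrier
  eval []      x = F.0#
  eval (a ∷ p) x = a F.+ x F.* eval p x

  graph : ∀ {d} → Poly≤ d → Pred (F.Carrier × F.Carrier) ℓ₁
  graph f (x , y) = y F.≈ eval f x

  module _ {d : ℕ} where
    open Membership (poly≤-setoid d) public using (_∈_)
    open UniqueSetoid (poly≤-setoid d) public using (Unique)

  Intersecting : ∀ {d} → List (Poly≤ d) → Set (c ⊔ ℓ₁)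
  Intersecting U = ∀ {f g} → f ∈ U → g ∈ U → ∃[ P ] (graph f P × graph g P)

  GraphsShareCommonPoint : ∀ {d} → List (Poly≤ d) → Set (c ⊔ ℓ₁)
  GraphsShareCommonPoint U = ∃[ P ] (∀ {f} → f ∈ U → graph f P)

-- The real inequality  ε < q√q/4 − q/8 − √q/8.  A nonnegative rational r
-- satisfies r ≤ √q exactly when r² ≤ q.  For q ≥ 1 the expression
-- qr/4 − q/8 − r/8 is continuous and strictly increasing in r, so ε lies
-- strictly below its value at √q iff it does so at some rational r ≤ √q.
BelowBound : ℕ → ℤ → Set
BelowBound q ε =
  ∃[ r ] (0ℚᵘ ≤ r × r * r ≤ (+ q) / 1 ×
          ε / 1 < ((+ q) / 1) * r * (+ 1 / 4) - (+ q) / 8 - r * (+ 1 / 8))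

{-# OPTIONS --safe #-}
module Submission where

-- Let S be the family, s = |S|, n x y the number of its members through (x , y), and
-- D f = Σₓ n x (f x).  In characteristic 2 a quadratic whose two top coefficients are
-- nonzero has two roots as soon as it has one, so two members of S with different top
-- and middle coefficients meet twice; as a pair (top , middle) determines a member, D is
-- at least 2s - q on S.  The values of a random quadratic at three distinct points are
-- independent, so over all q³ quadratics the second and third moments of D - s reduce to
-- power sums of the deviations of n from s / q.  Since D ≥ 0 everywhere, the members of S
-- alone force Σ n³ to be so large that some n x y exceeds (q - 1)(q + 2) / 2.  But a
-- member missing (x , y) meets at most that many members through (x , y).
-- For q = 4 the estimates are too tight and the integrality of n and D is used as well.

open import Defs
open import Algebra.Apartness.Bundles using (HeytingField)
open import Data.Integer using (ℤ; +_; _-_)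
open import Data.List using (List; length)
open import Data.Nat using (ℕ; _^_; _<_)
open import Data.Product using (∃-syntax)
open import Relation.Binary.PropositionalEquality using (_≡_)

open import Algebra.Bundles using (CommutativeRing)
open import Algebra.Core using (Op₁; Op₂)
import Algebra.Morphism.RingMonomorphism as RingMonomorphism
open import Algebra.Morphism.Structures using (IsRingMonomorphism)
import Algebra.Properties.Ring as RingProperties
import Algebra.Solver.Ring as RingSolver
open import Algebra.Solver.Ring.AlmostCommutativeRing using (_-Raw-AlmostCommutative⟶_; fromCommutativeRing)
open import Algebra.Structures using (IsCommutativeRing)
open import Data.Bool using (Bool; true; false; if_then_else_)
open import Data.Bool.Properties using (xor-∧-commutativeRing)
open import Data.Empty using (⊥; ⊥-elim)
open import Data.Fin as Fin using (Fin; _≟_)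
open import Data.Fin.Properties as FinP using (any?)
open import Data.Integer as ℤ using (-[1+_]; 0ℤ; 1ℤ; _+_; _*_; -_; _≤_; +≤+; +<+; Positive; positive; nonNegative; ≢-nonZero; ∣_∣)
import Data.Integer.Properties as ℤP
open import Data.Integer.Tactic.RingSolver using (solve-∀)
open import Data.List using ([]; _∷_; _++_; map; cartesianProduct; allFin)
open import Data.List.Membership.Propositional using (find) renaming (_∈_ to _∈ₚ_)
open import Data.List.Membership.Propositional.Properties
  using (∈-∃++; ∈-++⁻; ∈-++⁺ˡ; ∈-++⁺ʳ; ∈-allFin; ∈-cartesianProduct⁺)
open import Data.List.Membership.Setoid.Properties using (∈-map⁺; ∈-map⁻)
open import Data.List.Properties using (length-map; length-tabulate)
open import Data.List.Relation.Unary.All as All using ([]; _∷_)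
open import Data.List.Relation.Unary.All.Properties using (¬All⇒Any¬)
open import Data.List.Relation.Unary.AllPairs using ([]; _∷_)
open import Data.List.Relation.Unary.Any using (here; there)
open import Data.List.Relation.Unary.Unique.Propositional using () renaming (Unique to Uniqueₚ)
open import Data.List.Relation.Unary.Unique.Propositional.Properties using (allFin⁺)
open import Data.List.Relation.Unary.Unique.Setoid.Properties using (map⁺)
open import Data.Maybe using (Maybe; just; nothing)
open import Data.Nat as ℕ using (z≤n)
import Data.Nat.Properties as ℕP
open import Data.Product using (_×_; _,_; proj₁; proj₂)
open import Data.Product.Properties using (≡-dec)
open import Data.Rational.Unnormalised using (mkℚᵘ; *≤*; *<*)
open import Data.Sum using (_⊎_; inj₁; inj₂)
open import Data.Vec using (Vec; []; _∷_)
open import Data.Vec.Relation.Binary.Pointwise.Inductive using ([]; _∷_)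
open import Function using (_∘_; id)
open import Function.Bundles using (Inverse)
open import Level using (Level)
open import Relation.Binary.Bundles using (Setoid)
open import Relation.Binary.Definitions using (DecidableEquality; tri<; tri≈; tri>)
open import Relation.Binary.PropositionalEquality
  using (_≢_; refl; sym; trans; cong; cong₂; subst; subst₂; setoid; ≢-sym; module ≡-Reasoning)
open import Relation.Nullary using (Dec; yes; no; ¬_; contradiction)
open import Relation.Nullary.Decidable using (_×-dec_; from-no)
open import Relation.Unary using (Pred; Decidable)

-- Everything stays in the integers and is made linear in one quantity, E = `excess`, the sum of D -
-- s over S. Deviations are scaled by q, and Σ dev² equals q² E because weighting points by n
-- amounts to summing over members. What is compared on S and on all quadratics is D (D - s)² rather
-- than (D - s)³: the weight D ≥ 0 makes every omitted quadratic contribute nonnegatively, whereas D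
-- - s may be negative outside S. The upper bound on n turns the third moment into a multiple of E
-- as well, so for q ≥ 8 the positive factor q E divides out and a quadratic inequality in s
-- remains. For s = σ q² its leading part is 4 σ² - 2 σ - 1, positive once σ > (1 + √5) / 4, about
-- 0.81. The hypothesis on ε enters through √q ≤ q / 4 + 1, which gives 32 s ≥ 30 q² - 3 q + 4, so σ
-- is at least about 15 / 16. At q = 4 the same quadratic is 0 for s = 16 and -76 for s = 15, the
-- two sizes that can occur, and both need bounds of their own.

private variable
  a b p : Level
  A : Set a
  B : Set b

-- Integer sums over lists.

∑ : List A → (A → ℤ) → ℤ
∑ []       φ = 0ℤ
∑ (x ∷ xs) φ = φ x + ∑ xs φ

∑-cong-∈ : ∀ (xs : List A) {φ ψ : A → ℤ} → (∀ {x} → x ∈ₚ xs → φ x ≡ ψ x) → ∑ xs φ ≡ ∑ xs ψ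
∑-cong-∈ []       eq = refl
∑-cong-∈ (x ∷ xs) eq = cong₂ _+_ (eq (here refl)) (∑-cong-∈ xs (eq ∘ there))

∑-cong : ∀ (xs : List A) {φ ψ : A → ℤ} → (∀ x → φ x ≡ ψ x) → ∑ xs φ ≡ ∑ xs ψ
∑-cong xs eq = ∑-cong-∈ xs (λ {x} _ → eq x)

∑-mono-∈ : ∀ (xs : List A) {φ ψ : A → ℤ} → (∀ {x} → x ∈ₚ xs → φ x ≤ ψ x) → ∑ xs φ ≤ ∑ xs ψ
∑-mono-∈ []       le = ℤP.≤-refl
∑-mono-∈ (x ∷ xs) le = ℤP.+-mono-≤ (le (here refl)) (∑-mono-∈ xs (le ∘ there))

∑-mono : ∀ (xs : List A) {φ ψ : A → ℤ} → (∀ x → φ x ≤ ψ x) → ∑ xs φ ≤ ∑ xs ψ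
∑-mono xs le = ∑-mono-∈ xs (λ {x} _ → le x)

∑-const : ∀ (xs : List A) k → ∑ xs (λ _ → k) ≡ + length xs * k
∑-const []       k = refl
∑-const (x ∷ xs) k = begin
  k + ∑ xs (λ _ → k)     ≡⟨ cong (_+_ k) (∑-const xs k) ⟩
  k + + length xs * k    ≡⟨ distrib (+ length xs) k ⟩
  (1ℤ + + length xs) * k ∎
  where
  open ≡-Reasoning
  distrib : ∀ n k → k + n * k ≡ (1ℤ + n) * k
  distrib = solve-∀

∑-zero : ∀ (xs : List A) {φ : A → ℤ} → (∀ x → φ x ≡ 0ℤ) → ∑ xs φ ≡ 0ℤ
∑-zero []       eq = refl
∑-zero (x ∷ xs) eq = cong₂ _+_ (eq x) (∑-zero xs eq)

∑-nonneg : ∀ (xs : List A) {φ : A → ℤ} → (∀ x → 0ℤ ≤ φ x) → 0ℤ ≤ ∑ xs φ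
∑-nonneg []       nn = ℤP.≤-refl
∑-nonneg (x ∷ xs) nn = ℤP.+-mono-≤ (nn x) (∑-nonneg xs nn)

∑-+ : ∀ (xs : List A) (φ ψ : A → ℤ) → ∑ xs (λ x → φ x + ψ x) ≡ ∑ xs φ + ∑ xs ψ
∑-+ []       φ ψ = refl
∑-+ (x ∷ xs) φ ψ = trans (cong (_+_ (φ x + ψ x)) (∑-+ xs φ ψ)) (interchange (φ x) (ψ x) (∑ xs φ) (∑ xs ψ))
  where
  interchange : ∀ a b c d → a + b + (c + d) ≡ a + c + (b + d)
  interchange = solve-∀

∑-* : ∀ (xs : List A) k (φ : A → ℤ) → ∑ xs (λ x → k * φ x) ≡ k * ∑ xs φ
∑-* []       k φ = sym (ℤP.*-zeroʳ k)
∑-* (x ∷ xs) k φ = trans (cong (_+_ (k * φ x)) (∑-* xs k φ)) (sym (ℤP.*-distribˡ-+ k (φ x) (∑ xs φ)))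

∑-swap : ∀ (xs : List A) (ys : List B) (φ : A → B → ℤ) →
  ∑ xs (λ x → ∑ ys (φ x)) ≡ ∑ ys (λ y → ∑ xs (λ x → φ x y))
∑-swap []       ys φ = sym (∑-zero ys (λ _ → refl))
∑-swap (x ∷ xs) ys φ =
  trans (cong (_+_ (∑ ys (φ x))) (∑-swap xs ys φ)) (sym (∑-+ ys (φ x) (λ y → ∑ xs (λ x → φ x y))))

∑-++ : ∀ (xs ys : List A) (φ : A → ℤ) → ∑ (xs ++ ys) φ ≡ ∑ xs φ + ∑ ys φ
∑-++ []       ys φ = sym (ℤP.+-identityˡ _)
∑-++ (x ∷ xs) ys φ = trans (cong (_+_ (φ x)) (∑-++ xs ys φ)) (sym (ℤP.+-assoc (φ x) _ _))

∑-map : ∀ (f : A → B) xs (φ : B → ℤ) → ∑ (map f xs) φ ≡ ∑ xs (φ ∘ f)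
∑-map f []       φ = refl
∑-map f (x ∷ xs) φ = cong (_+_ (φ (f x))) (∑-map f xs φ)

∑-cartesianProduct : ∀ (xs : List A) (ys : List B) (φ : A × B → ℤ) →
  ∑ (cartesianProduct xs ys) φ ≡ ∑ xs (λ x → ∑ ys (λ y → φ (x , y)))
∑-cartesianProduct []       ys φ = refl
∑-cartesianProduct (x ∷ xs) ys φ =
  trans (∑-++ (map (x ,_) ys) _ φ) (cong₂ _+_ (∑-map (x ,_) ys φ) (∑-cartesianProduct xs ys φ))

∑-single : ∀ {xs : List A} {z} {φ : A → ℤ} → Uniqueₚ xs → z ∈ₚ xs →
  (∀ y → y ≢ z → φ y ≡ 0ℤ) → ∑ xs φ ≡ φ z
∑-single {xs = x ∷ xs} {φ = φ} (x∉ ∷ _) (here refl) off =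
  trans (cong (_+_ (φ x)) (trans (∑-cong-∈ xs (λ y∈ → off _ (≢-sym (All.lookup x∉ y∈)))) (∑-zero xs (λ _ → refl))))
        (ℤP.+-identityʳ (φ x))
∑-single {xs = x ∷ xs} {φ = φ} (x∉ ∷ u) (there z∈) off =
  trans (cong₂ _+_ (off x (All.lookup x∉ z∈)) (∑-single u z∈ off)) (ℤP.+-identityˡ _)

-- Each element of `xs` is located in `ys` and deleted there; since `xs` has no repetitions, the
-- deletion takes nothing that a later element needs.
∑-⊆ : ∀ {xs ys : List A} {φ : A → ℤ} → Uniqueₚ xs → (∀ {x} → x ∈ₚ xs → x ∈ₚ ys) →
  (∀ y → 0ℤ ≤ φ y) → ∑ xs φ ≤ ∑ ys φ
∑-⊆ {xs = []} {ys} [] sub nn = ∑-nonneg ys nn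
∑-⊆ {xs = x ∷ xs} {φ = φ} (x∉ ∷ u) sub nn with ∈-∃++ (sub (here refl))
... | us , vs , refl = begin
  φ x + ∑ xs φ               ≤⟨ ℤP.+-monoʳ-≤ (φ x) (∑-⊆ u sub′ nn) ⟩
  φ x + ∑ (us ++ vs) φ       ≡⟨ cong (_+_ (φ x)) (∑-++ us vs φ) ⟩
  φ x + (∑ us φ + ∑ vs φ)    ≡⟨ rotate (φ x) (∑ us φ) (∑ vs φ) ⟩
  ∑ us φ + (φ x + ∑ vs φ)    ≡⟨ ∑-++ us (x ∷ vs) φ ⟨
  ∑ (us ++ x ∷ vs) φ         ∎
  where
  open ℤP.≤-Reasoning
  rotate : ∀ a b c → a + (b + c) ≡ b + (a + c)
  rotate = solve-∀
  sub′ : ∀ {y} → y ∈ₚ xs → y ∈ₚ us ++ vs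
  sub′ y∈ with ∈-++⁻ us (sub (there y∈))
  ... | inj₁ y∈us          = ∈-++⁺ˡ y∈us
  ... | inj₂ (here refl)   = contradiction refl (All.lookup x∉ y∈)
  ... | inj₂ (there y∈vs)  = ∈-++⁺ʳ us y∈vs

-- Indicators and sums over `Fin q`.

𝟙 : {A : Set a} → Dec A → ℤ
𝟙 (yes _) = 1ℤ
𝟙 (no  _) = 0ℤ

0≤𝟙 : (d : Dec A) → 0ℤ ≤ 𝟙 d
0≤𝟙 (yes _) = +≤+ z≤n
0≤𝟙 (no  _) = +≤+ z≤n

𝟙-yes : (d : Dec A) → A → 𝟙 d ≡ 1ℤ
𝟙-yes (yes _) x  = refl
𝟙-yes (no ¬x) x  = contradiction x ¬x

𝟙-no : (d : Dec A) → ¬ A → 𝟙 d ≡ 0ℤ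
𝟙-no (yes x) ¬x = contradiction x ¬x
𝟙-no (no  _) ¬x = refl

𝟙-⇔ : (d : Dec A) (e : Dec B) → (A → B) → (B → A) → 𝟙 d ≡ 𝟙 e
𝟙-⇔ (yes x) e to from = sym (𝟙-yes e (to x))
𝟙-⇔ (no ¬x) e to from = sym (𝟙-no e (¬x ∘ from))

∑-𝟙≤1 : ∀ {A : Set a} {P : Pred A p} (P? : Decidable P) {xs : List A} → Uniqueₚ xs →
  (∀ {x y} → x ∈ₚ xs → y ∈ₚ xs → P x → P y → x ≡ y) → ∑ xs (𝟙 ∘ P?) ≤ 1ℤ
∑-𝟙≤1 P? {[]} [] inj = +≤+ z≤n
∑-𝟙≤1 P? {x ∷ xs} (x∉ ∷ u) inj with P? x
... | no  _  = subst (_≤ 1ℤ) (sym (ℤP.+-identityˡ _)) (∑-𝟙≤1 P? u (λ x∈ y∈ → inj (there x∈) (there y∈)))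
... | yes px = ℤP.≤-reflexive (cong (_+_ (1ℤ)) (trans
      (∑-cong-∈ xs (λ y∈ → 𝟙-no (P? _) (λ py → All.lookup x∉ y∈ (inj (here refl) (there y∈) px py))))
      (∑-zero xs (λ _ → refl))))

module _ {q : ℕ} where

  ∑ꟳ : (Fin q → ℤ) → ℤ
  ∑ꟳ = ∑ (allFin q)

  ∑ꟳ-const : ∀ k → ∑ꟳ (λ _ → k) ≡ + q * k
  ∑ꟳ-const k = trans (∑-const (allFin q) k) (cong (λ n → + n * k) (length-tabulate {n = q} id))

  ∑ꟳ-single : ∀ z {φ : Fin q → ℤ} → (∀ y → y ≢ z → φ y ≡ 0ℤ) → ∑ꟳ φ ≡ φ z
  ∑ꟳ-single z = ∑-single (allFin⁺ q) (∈-allFin z)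

  ∑ꟳ-𝟙 : ∀ z → ∑ꟳ (λ y → 𝟙 (z ≟ y)) ≡ 1ℤ
  ∑ꟳ-𝟙 z = trans (∑ꟳ-single z (λ y y≢z → 𝟙-no (z ≟ y) (≢-sym y≢z))) (𝟙-yes (z ≟ z) refl)

  ∑ꟳ-sift : ∀ z (φ : Fin q → ℤ) → ∑ꟳ (λ y → 𝟙 (z ≟ y) * φ y) ≡ φ z
  ∑ꟳ-sift z φ = begin
    ∑ꟳ (λ y → 𝟙 (z ≟ y) * φ y)  ≡⟨ ∑ꟳ-single z (λ y y≢z → cong (_* φ y) (𝟙-no (z ≟ y) (≢-sym y≢z))) ⟩
    𝟙 (z ≟ z) * φ z             ≡⟨ cong (_* φ z) (𝟙-yes (z ≟ z) refl) ⟩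
    1ℤ * φ z                    ≡⟨ ℤP.*-identityˡ (φ z) ⟩
    φ z                         ∎
    where open ≡-Reasoning

  -- Writing φ (σ x) as a sum over y of indicators of σ x = y reduces a change of variables to
  -- exchanging two sums, without permuting `allFin`.
  ∑ꟳ-reindex : ∀ {σ τ : Fin q → Fin q} → (∀ y → σ (τ y) ≡ y) → (∀ x → τ (σ x) ≡ x) →
    ∀ φ → ∑ꟳ (φ ∘ σ) ≡ ∑ꟳ φ
  ∑ꟳ-reindex {σ} {τ} στ τσ φ = begin
    ∑ꟳ (φ ∘ σ)                                  ≡⟨ ∑-cong (allFin q) (λ x → ∑ꟳ-sift (σ x) φ) ⟨
    ∑ꟳ (λ x → ∑ꟳ (λ y → 𝟙 (σ x ≟ y) * φ y))     ≡⟨ ∑-swap (allFin q) (allFin q) _ ⟩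
    ∑ꟳ (λ y → ∑ꟳ (λ x → 𝟙 (σ x ≟ y) * φ y))     ≡⟨ ∑-cong (allFin q) (λ y → ∑-cong (allFin q) (λ x →
                                                      cong (_* φ y) (𝟙-⇔ (σ x ≟ y) (τ y ≟ x)
                                                        (λ { refl → τσ x }) (λ { refl → στ y })))) ⟩
    ∑ꟳ (λ y → ∑ꟳ (λ x → 𝟙 (τ y ≟ x) * φ y))     ≡⟨ ∑-cong (allFin q) (λ y → ∑ꟳ-sift (τ y) (λ _ → φ y)) ⟩
    ∑ꟳ φ                                        ∎
    where open ≡-Reasoning

Fin⇒≢0 : ∀ {n} → Fin n → + n ≢ 0ℤ
Fin⇒≢0 {ℕ.suc n} i ()

-- Quadratics over a finite field of characteristic 2 and sums over all of them.

module FiniteFieldOfCharacteristic2 {q : ℕ} {_⊕_ _⊗_ : Op₂ (Fin q)} {⊖_ : Op₁ (Fin q)} {0K 1K : Fin q}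
  (isCommutativeRing : IsCommutativeRing _≡_ _⊕_ _⊗_ ⊖_ 0K 1K)
  (1⊕1≡0 : 1K ⊕ 1K ≡ 0K)
  (inverse : ∀ x → x ≢ 0K → ∃[ y ] y ⊗ x ≡ 1K)
  where

  private
    ring : CommutativeRing _ _
    ring = record { isCommutativeRing = isCommutativeRing }

    open IsCommutativeRing isCommutativeRing
      using (+-identityˡ; +-identityʳ; *-identityˡ; *-identityʳ; zeroˡ; zeroʳ; +-assoc; *-assoc; -‿inverseʳ)

    1-self-inverse : ⊖ 1K ≡ 1K
    1-self-inverse = begin
      ⊖ 1K                 ≡⟨ +-identityˡ (⊖ 1K) ⟨
      0K ⊕ (⊖ 1K)          ≡⟨ cong (_⊕ (⊖ 1K)) 1⊕1≡0 ⟨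
      (1K ⊕ 1K) ⊕ (⊖ 1K)   ≡⟨ +-assoc 1K 1K (⊖ 1K) ⟩
      1K ⊕ (1K ⊕ (⊖ 1K))   ≡⟨ cong (1K ⊕_) (-‿inverseʳ 1K) ⟩
      1K ⊕ 0K              ≡⟨ +-identityʳ 1K ⟩
      1K                   ∎
      where open ≡-Reasoning

    ⟦_⟧𝔹 : Bool → Fin q
    ⟦ b ⟧𝔹 = if b then 1K else 0K

    -- With coefficients in 𝔽₂ the solver cancels x ⊕ x.
    fromBool : CommutativeRing.rawRing xor-∧-commutativeRing -Raw-AlmostCommutative⟶ fromCommutativeRing ring
    fromBool = record
      { ⟦_⟧    = ⟦_⟧𝔹
      ; +-homo = λ { false y → sym (+-identityˡ _) ; true false → sym (+-identityʳ 1K) ; true true → sym 1⊕1≡0 }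
      ; *-homo = λ { false y → sym (zeroˡ _) ; true y → sym (*-identityˡ _) }
      ; -‿homo = λ { false → sym (RingProperties.-0#≈0# (CommutativeRing.ring ring)) ; true → sym 1-self-inverse }
      ; 0-homo = refl
      ; 1-homo = refl
      }

    _≟⟦⟧_ : ∀ a b → Maybe (⟦ a ⟧𝔹 ≡ ⟦ b ⟧𝔹)
    false ≟⟦⟧ false = just refl
    true  ≟⟦⟧ true  = just refl
    _     ≟⟦⟧ _     = nothing

  open RingSolver (CommutativeRing.rawRing xor-∧-commutativeRing) (fromCommutativeRing ring) fromBool _≟⟦⟧_ public
    using (solve; _:+_; _:*_; _:=_; con)

  ⊕≡0⇒≡ : ∀ {x y} → x ⊕ y ≡ 0K → x ≡ y
  ⊕≡0⇒≡ {x} {y} x⊕y≡0 = begin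
    x            ≡⟨ solve 2 (λ x y → x := (x :+ y) :+ y) refl x y ⟩
    (x ⊕ y) ⊕ y  ≡⟨ cong (_⊕ y) x⊕y≡0 ⟩
    0K ⊕ y       ≡⟨ +-identityˡ y ⟩
    y            ∎
    where open ≡-Reasoning

  ⊗≢0 : ∀ {x y} → x ≢ 0K → y ≢ 0K → x ⊗ y ≢ 0K
  ⊗≢0 {x} {y} x≢0 y≢0 xy≡0 with inverse x x≢0
  ... | x⁻¹ , x⁻¹x≡1 = y≢0 (begin
    y                ≡⟨ *-identityˡ y ⟨
    1K ⊗ y           ≡⟨ cong (_⊗ y) x⁻¹x≡1 ⟨
    (x⁻¹ ⊗ x) ⊗ y    ≡⟨ *-assoc x⁻¹ x y ⟩
    x⁻¹ ⊗ (x ⊗ y)    ≡⟨ cong (x⁻¹ ⊗_) xy≡0 ⟩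
    x⁻¹ ⊗ 0K         ≡⟨ zeroʳ x⁻¹ ⟩
    0K               ∎)
    where open ≡-Reasoning

  ∑ꟳ-shift : ∀ t φ → ∑ꟳ (λ x → φ (x ⊕ t)) ≡ ∑ꟳ φ
  ∑ꟳ-shift t = ∑ꟳ-reindex {τ = _⊕ t} involutive involutive
    where
    involutive : ∀ x → (x ⊕ t) ⊕ t ≡ x
    involutive x = solve 2 (λ x t → (x :+ t) :+ t := x) refl x t

  ∑ꟳ-affine : ∀ s {u} → u ≢ 0K → ∀ φ → ∑ꟳ (λ t → φ (s ⊕ (t ⊗ u))) ≡ ∑ꟳ φ
  ∑ꟳ-affine s {u} u≢0 with inverse u u≢0
  ... | u⁻¹ , u⁻¹u≡1 = ∑ꟳ-reindex {τ = λ y → (s ⊕ y) ⊗ u⁻¹} right left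
    where
    open ≡-Reasoning
    right : ∀ y → s ⊕ (((s ⊕ y) ⊗ u⁻¹) ⊗ u) ≡ y
    right y = begin
      s ⊕ (((s ⊕ y) ⊗ u⁻¹) ⊗ u)  ≡⟨ cong (s ⊕_) (*-assoc (s ⊕ y) u⁻¹ u) ⟩
      s ⊕ ((s ⊕ y) ⊗ (u⁻¹ ⊗ u))  ≡⟨ cong (λ e → s ⊕ ((s ⊕ y) ⊗ e)) u⁻¹u≡1 ⟩
      s ⊕ ((s ⊕ y) ⊗ 1K)         ≡⟨ solve 2 (λ s y → s :+ ((s :+ y) :* con true) := y) refl s y ⟩
      y                          ∎
    left : ∀ t → (s ⊕ (s ⊕ (t ⊗ u))) ⊗ u⁻¹ ≡ t
    left t = begin
      (s ⊕ (s ⊕ (t ⊗ u))) ⊗ u⁻¹  ≡⟨ solve 4 (λ s t u w → (s :+ (s :+ (t :* u))) :* w := t :* (w :* u)) refl s t u u⁻¹ ⟩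
      t ⊗ (u⁻¹ ⊗ u)              ≡⟨ cong (t ⊗_) u⁻¹u≡1 ⟩
      t ⊗ 1K                     ≡⟨ *-identityʳ t ⟩
      t                          ∎

  -- (a , b , c) stands for a X² + b X + c.
  Quadratic : Set
  Quadratic = Fin q × Fin q × Fin q

  value : Fin q → Quadratic → Fin q
  value x (a , b , c) = c ⊕ (x ⊗ (b ⊕ (x ⊗ a)))

  quadratics : List Quadratic
  quadratics = cartesianProduct (allFin q) (cartesianProduct (allFin q) (allFin q))

  ∈-quadratics : ∀ f → f ∈ₚ quadratics
  ∈-quadratics (a , b , c) = ∈-cartesianProduct⁺ (∈-allFin a) (∈-cartesianProduct⁺ (∈-allFin b) (∈-allFin c))

  ∑ᴾ : (Quadratic → ℤ) → ℤ
  ∑ᴾ = ∑ quadratics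

  ∑ᴾ-iterated : ∀ Ψ → ∑ᴾ Ψ ≡ ∑ꟳ (λ a → ∑ꟳ (λ b → ∑ꟳ (λ c → Ψ (a , b , c))))
  ∑ᴾ-iterated Ψ = trans (∑-cartesianProduct (allFin q) _ Ψ)
    (∑-cong (allFin q) (λ a → ∑-cartesianProduct (allFin q) (allFin q) (λ bc → Ψ (a , bc))))

  _⊞_·_ : Quadratic → Fin q → Quadratic → Quadratic
  (a , b , c) ⊞ t · (a′ , b′ , c′) = a ⊕ (t ⊗ a′) , b ⊕ (t ⊗ b′) , c ⊕ (t ⊗ c′)

  ∑ᴾ-translate : ∀ t w Ψ → ∑ᴾ (λ f → Ψ (f ⊞ t · w)) ≡ ∑ᴾ Ψ
  ∑ᴾ-translate t w@(a′ , b′ , c′) Ψ = begin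
    ∑ᴾ (λ f → Ψ (f ⊞ t · w))
      ≡⟨ ∑ᴾ-iterated _ ⟩
    ∑ꟳ (λ a → ∑ꟳ (λ b → ∑ꟳ (λ c → Ψ (a ⊕ (t ⊗ a′) , b ⊕ (t ⊗ b′) , c ⊕ (t ⊗ c′)))))
      ≡⟨ ∑-cong (allFin q) (λ a → ∑-cong (allFin q) (λ b → ∑ꟳ-shift (t ⊗ c′) (λ c → Ψ (_ , _ , c)))) ⟩
    ∑ꟳ (λ a → ∑ꟳ (λ b → ∑ꟳ (λ c → Ψ (a ⊕ (t ⊗ a′) , b ⊕ (t ⊗ b′) , c))))
      ≡⟨ ∑-cong (allFin q) (λ a → ∑ꟳ-shift (t ⊗ b′) (λ b → ∑ꟳ (λ c → Ψ (_ , b , c)))) ⟩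
    ∑ꟳ (λ a → ∑ꟳ (λ b → ∑ꟳ (λ c → Ψ (a ⊕ (t ⊗ a′) , b , c))))
      ≡⟨ ∑ꟳ-shift (t ⊗ a′) (λ a → ∑ꟳ (λ b → ∑ꟳ (λ c → Ψ (a , b , c)))) ⟩
    ∑ꟳ (λ a → ∑ꟳ (λ b → ∑ꟳ (λ c → Ψ (a , b , c))))
      ≡⟨ ∑ᴾ-iterated Ψ ⟨
    ∑ᴾ Ψ ∎
    where open ≡-Reasoning

  -- Tool for all independence statements: the space of quadratics is averaged along lines in a
  -- direction w, chosen so that some values stay fixed while another sweeps the field. The factor q
  -- stands in for a division.
  ∑ᴾ-average : ∀ w Ψ → + q * ∑ᴾ Ψ ≡ ∑ᴾ (λ f → ∑ꟳ (λ t → Ψ (f ⊞ t · w)))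
  ∑ᴾ-average w Ψ = begin
    + q * ∑ᴾ Ψ                           ≡⟨ ∑ꟳ-const {q} (∑ᴾ Ψ) ⟨
    ∑ꟳ {q} (λ _ → ∑ᴾ Ψ)                    ≡⟨ ∑-cong (allFin q) (λ t → ∑ᴾ-translate t w Ψ) ⟨
    ∑ꟳ (λ t → ∑ᴾ (λ f → Ψ (f ⊞ t · w)))  ≡⟨ ∑-swap (allFin q) quadratics _ ⟩
    ∑ᴾ (λ f → ∑ꟳ (λ t → Ψ (f ⊞ t · w)))  ∎
    where open ≡-Reasoning

  ∑ᴾ-value : ∀ x φ → ∑ᴾ (λ f → φ (value x f)) ≡ + q * (+ q * ∑ꟳ φ)
  ∑ᴾ-value x φ = begin
    ∑ᴾ (λ f → φ (value x f))
      ≡⟨ ∑ᴾ-iterated _ ⟩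
    ∑ꟳ (λ a → ∑ꟳ (λ b → ∑ꟳ (λ c → φ (c ⊕ (x ⊗ (b ⊕ (x ⊗ a)))))))
      ≡⟨ ∑-cong (allFin q) (λ a → ∑-cong (allFin q) (λ b → ∑ꟳ-shift _ φ)) ⟩
    ∑ꟳ (λ (a : Fin q) → ∑ꟳ (λ (b : Fin q) → ∑ꟳ φ))
      ≡⟨ ∑-cong (allFin q) (λ a → ∑ꟳ-const {q} (∑ꟳ φ)) ⟩
    ∑ꟳ (λ (a : Fin q) → + q * ∑ꟳ φ)
      ≡⟨ ∑ꟳ-const {q} (+ q * ∑ꟳ φ) ⟩
    + q * (+ q * ∑ꟳ φ) ∎
    where open ≡-Reasoning

  q≢0 : + q ≢ 0ℤ
  q≢0 = Fin⇒≢0 0K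

  -- Adding multiples of (X + x₁)(X + x₂) moves the value at x through the whole
  -- field while the values at x₁ and x₂ stay put.
  ∑ᴾ-mean-zero : ∀ {x x₁ x₂} → x ≢ x₁ → x ≢ x₂ → ∀ {φ} → ∑ꟳ φ ≡ 0ℤ → ∀ (ψ : Fin q → Fin q → ℤ) →
    ∑ᴾ (λ f → φ (value x f) * ψ (value x₁ f) (value x₂ f)) ≡ 0ℤ
  ∑ᴾ-mean-zero {x} {x₁} {x₂} x≢x₁ x≢x₂ {φ} ∑φ≡0 ψ =
    ℤP.*-cancelˡ-≡ (+ q) _ _ {{≢-nonZero q≢0}} (begin
    + q * ∑ᴾ Ψ
      ≡⟨ ∑ᴾ-average w Ψ ⟩
    ∑ᴾ (λ f → ∑ꟳ (λ t → Ψ (f ⊞ t · w)))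
      ≡⟨ ∑-zero quadratics averages-to-zero ⟩
    0ℤ
      ≡⟨ ℤP.*-zeroʳ (+ q) ⟨
    + q * 0ℤ ∎)
    where
    open ≡-Reasoning
    Ψ : Quadratic → ℤ
    Ψ f = φ (value x f) * ψ (value x₁ f) (value x₂ f)

    w : Quadratic
    w = 1K , x₁ ⊕ x₂ , x₁ ⊗ x₂

    x-moves : ∀ f t → value x (f ⊞ t · w) ≡ value x f ⊕ (t ⊗ ((x ⊕ x₁) ⊗ (x ⊕ x₂)))
    x-moves (a , b , c) t = solve 7
      (λ x x₁ x₂ a b c t →
        (c :+ t :* (x₁ :* x₂)) :+ x :* ((b :+ t :* (x₁ :+ x₂)) :+ x :* (a :+ t :* con true))
        := (c :+ x :* (b :+ x :* a)) :+ t :* ((x :+ x₁) :* (x :+ x₂)))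
      refl x x₁ x₂ a b c t

    x₁-fixed : ∀ f t → value x₁ (f ⊞ t · w) ≡ value x₁ f
    x₁-fixed (a , b , c) t = solve 6
      (λ x₁ x₂ a b c t →
        (c :+ t :* (x₁ :* x₂)) :+ x₁ :* ((b :+ t :* (x₁ :+ x₂)) :+ x₁ :* (a :+ t :* con true))
        := c :+ x₁ :* (b :+ x₁ :* a))
      refl x₁ x₂ a b c t

    x₂-fixed : ∀ f t → value x₂ (f ⊞ t · w) ≡ value x₂ f
    x₂-fixed (a , b , c) t = solve 6
      (λ x₁ x₂ a b c t →
        (c :+ t :* (x₁ :* x₂)) :+ x₂ :* ((b :+ t :* (x₁ :+ x₂)) :+ x₂ :* (a :+ t :* con true))
        := c :+ x₂ :* (b :+ x₂ :* a))
      refl x₁ x₂ a b c t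

    averages-to-zero : ∀ f → ∑ꟳ (λ t → Ψ (f ⊞ t · w)) ≡ 0ℤ
    averages-to-zero f = begin
      ∑ꟳ (λ t → Ψ (f ⊞ t · w))
        ≡⟨ ∑-cong (allFin q) factor ⟩
      ∑ꟳ (λ t → k * φ (move t))
        ≡⟨ ∑-* (allFin q) k (φ ∘ move) ⟩
      k * ∑ꟳ (φ ∘ move)
        ≡⟨ cong (k *_) (∑ꟳ-affine (value x f) (⊗≢0 (x≢x₁ ∘ ⊕≡0⇒≡) (x≢x₂ ∘ ⊕≡0⇒≡)) φ) ⟩
      k * ∑ꟳ φ
        ≡⟨ cong (k *_) ∑φ≡0 ⟩
      k * 0ℤ
        ≡⟨ ℤP.*-zeroʳ k ⟩
      0ℤ ∎
      where
      k = ψ (value x₁ f) (value x₂ f)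
      move : Fin q → Fin q
      move t = value x f ⊕ (t ⊗ ((x ⊕ x₁) ⊗ (x ⊕ x₂)))
      factor : ∀ t → Ψ (f ⊞ t · w) ≡ k * φ (move t)
      factor t = trans (cong₂ _*_ (cong φ (x-moves f t)) (cong₂ ψ (x₁-fixed f t) (x₂-fixed f t)))
                       (ℤP.*-comm (φ (move t)) k)

  -- Adding multiples of X + x₀ fixes the value at x₀ and moves the value at x bijectively through
  -- the field. So a fraction 1 / q of the q² quadratics through the first point passes through the
  -- second.
  ∑ᴾ-through-two-points : ∀ {x x₀} → x ≢ x₀ → ∀ y₀ y →
    ∑ᴾ (λ f → 𝟙 (value x₀ f ≟ y₀) * 𝟙 (value x f ≟ y)) ≡ + q
  ∑ᴾ-through-two-points {x} {x₀} x≢x₀ y₀ y =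
    ℤP.*-cancelˡ-≡ (+ q) _ _ {{≢-nonZero q≢0}} (begin
    + q * ∑ᴾ Ψ
      ≡⟨ ∑ᴾ-average w Ψ ⟩
    ∑ᴾ (λ f → ∑ꟳ (λ t → Ψ (f ⊞ t · w)))
      ≡⟨ ∑-cong quadratics averages-to-indicator ⟩
    ∑ᴾ (λ f → 𝟙 (value x₀ f ≟ y₀))
      ≡⟨ ∑ᴾ-value x₀ (λ y → 𝟙 (y ≟ y₀)) ⟩
    + q * (+ q * ∑ꟳ (λ y → 𝟙 (y ≟ y₀)))
      ≡⟨ cong (λ e → + q * (+ q * e)) (∑-𝟙≟ y₀) ⟩
    + q * (+ q * 1ℤ)
      ≡⟨ cong (+ q *_) (ℤP.*-identityʳ (+ q)) ⟩
    + q * + q ∎)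
    where
    open ≡-Reasoning
    Ψ : Quadratic → ℤ
    Ψ f = 𝟙 (value x₀ f ≟ y₀) * 𝟙 (value x f ≟ y)

    w : Quadratic
    w = 0K , 1K , x₀

    ∑-𝟙≟ : ∀ (y : Fin q) → ∑ꟳ (λ z → 𝟙 (z ≟ y)) ≡ 1ℤ
    ∑-𝟙≟ y = trans (∑-cong (allFin q) (λ z → 𝟙-⇔ (z ≟ y) (y ≟ z) sym sym)) (∑ꟳ-𝟙 y)

    x-moves : ∀ f t → value x (f ⊞ t · w) ≡ value x f ⊕ (t ⊗ (x ⊕ x₀))
    x-moves (a , b , c) t = solve 6
      (λ x x₀ a b c t →
        (c :+ t :* x₀) :+ x :* ((b :+ t :* con true) :+ x :* (a :+ t :* con false))
        := (c :+ x :* (b :+ x :* a)) :+ t :* (x :+ x₀))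
      refl x x₀ a b c t

    x₀-fixed : ∀ f t → value x₀ (f ⊞ t · w) ≡ value x₀ f
    x₀-fixed (a , b , c) t = solve 5
      (λ x₀ a b c t →
        (c :+ t :* x₀) :+ x₀ :* ((b :+ t :* con true) :+ x₀ :* (a :+ t :* con false))
        := c :+ x₀ :* (b :+ x₀ :* a))
      refl x₀ a b c t

    averages-to-indicator : ∀ f → ∑ꟳ (λ t → Ψ (f ⊞ t · w)) ≡ 𝟙 (value x₀ f ≟ y₀)
    averages-to-indicator f = begin
      ∑ꟳ (λ t → Ψ (f ⊞ t · w))
        ≡⟨ ∑-cong (allFin q) (λ t → cong₂ (λ y′ y″ → 𝟙 (y′ ≟ y₀) * 𝟙 (y″ ≟ y)) (x₀-fixed f t) (x-moves f t)) ⟩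
      ∑ꟳ (λ t → k * 𝟙 (move t ≟ y))
        ≡⟨ ∑-* (allFin q) k (λ t → 𝟙 (move t ≟ y)) ⟩
      k * ∑ꟳ (λ t → 𝟙 (move t ≟ y))
        ≡⟨ cong (k *_) (trans (∑ꟳ-affine (value x f) (x≢x₀ ∘ ⊕≡0⇒≡) (λ z → 𝟙 (z ≟ y))) (∑-𝟙≟ y)) ⟩
      k * 1ℤ
        ≡⟨ ℤP.*-identityʳ k ⟩
      k ∎
      where
      k = 𝟙 (value x₀ f ≟ y₀)
      move : Fin q → Fin q
      move t = value x f ⊕ (t ⊗ (x ⊕ x₀))

-- Integer inequalities and the final numerical contradictions.

-- Format of the later estimates: a slack `d`, visibly nonnegative as a sum of products, together
-- with a polynomial identity left to the ring solver.
≤-by : ∀ {x y} d → 0ℤ ≤ d → x + d ≡ y → x ≤ y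
≤-by {x} d 0≤d eq = subst₂ _≤_ (ℤP.+-identityʳ x) eq (ℤP.+-monoʳ-≤ x 0≤d)

0≤+ : ∀ {x y} → 0ℤ ≤ x → 0ℤ ≤ y → 0ℤ ≤ x + y
0≤+ = ℤP.+-mono-≤

0≤* : ∀ {x y} → 0ℤ ≤ x → 0ℤ ≤ y → 0ℤ ≤ x * y
0≤* {x} {y} 0≤x 0≤y = subst (_≤ x * y) (ℤP.*-zeroʳ x) (ℤP.*-monoˡ-≤-nonNeg x {{nonNegative 0≤x}} 0≤y)

0≤+ₙ : ∀ {n} → 0ℤ ≤ + n
0≤+ₙ = +≤+ z≤n

0≤square : ∀ x → 0ℤ ≤ x * x
0≤square (+ n)      = subst (0ℤ ≤_) (ℤP.pos-* n n) 0≤+ₙ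
0≤square (-[1+ n ]) = 0≤+ₙ

0<* : ∀ {x y} → 0ℤ ℤ.< x → 0ℤ ℤ.< y → 0ℤ ℤ.< x * y
0<* {x} {y} 0<x 0<y = subst (ℤ._< x * y) (ℤP.*-zeroʳ x) (ℤP.*-monoˡ-<-pos x {{positive 0<x}} 0<y)

-- No integer lies strictly between 0 and 1; through this fact the integrality of n and D enters the
-- case q = 4.
0≤i[i-1] : ∀ i → 0ℤ ≤ i * (i - 1ℤ)
0≤i[i-1] (+ 0)         = 0≤+ₙ
0≤i[i-1] (+ ℕ.suc n)   = 0≤* {+ ℕ.suc n} {+ n} 0≤+ₙ 0≤+ₙ
0≤i[i-1] (-[1+ n ])    = 0≤+ₙ

-- Here E, T and C are excess, ∑dev³ and ∑cubic.  Written in r = q - 8 and the slack u of the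
-- hypothesis on s, all polynomials involved have positive coefficients.
8≤q-contradiction : ∀ q s C T E → + 8 ≤ q → 0ℤ ≤ + 32 * s - (+ 30 * (q * q) - + 3 * q + + 4) →
  s * (s - q) ≤ E →
  (0ℤ ≤ s - q → (+ 2 * s - q) * (s - q) * E ≤ C) →
  + 2 * T ≤ (q * (q * q + q - + 2) - + 2 * s) * (q * (q * E)) →
  q * C ≤ T + q * (q * (q * (s * E))) → ⊥
8≤q-contradiction q s C T E 8≤q 0≤u E≥ C≥ T≤ third = ℤP.<⇒≱ (ℤP.neg-mono-< 0<qEf) 0≤-qEf
  where
  r u g w f : ℤ
  r = q - + 8
  u = + 32 * s - (+ 30 * (q * q) - + 3 * q + + 4)
  g = u + (+ 1644 + r * (+ 445 + r * + 30))
  w = + 63888 + (r * (+ 97784 + r * (+ 31929 + r * (+ 3900 + r * + 164))) + (u * (+ 2520 + r * (+ 666 + r * + 44)) + u * u))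
  -- The hypotheses on C, T and `third` combine to q E f ≤ 0; this `f` is what is left after the
  -- common factor q E is taken out.
  f = + 4 * (s * s) - (+ 2 * (q * q) + + 4 * q) * s + (+ 4 * (q * q) - q * (q * q) - (q * q) * (q * q))

  0≤r : 0ℤ ≤ r
  0≤r = ℤP.i≤j⇒0≤j-i 8≤q
  1≤g : 1ℤ ≤ g
  1≤g = ≤-by (u + (+ 1643 + r * (+ 445 + r * + 30)))
    (0≤+ 0≤u (0≤+ 0≤+ₙ (0≤* 0≤r (0≤+ 0≤+ₙ (0≤* 0≤r 0≤+ₙ))))) (shift u (r * (+ 445 + r * + 30)))
    where
    shift : ∀ a b → 1ℤ + (a + (+ 1643 + b)) ≡ a + (+ 1644 + b)
    shift = solve-∀
  32[s-q]≡g : + 32 * (s - q) ≡ g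
  32[s-q]≡g = identity q s
    where
    identity : ∀ q s → + 32 * (s - q) ≡ + 32 * s - (+ 30 * (q * q) - + 3 * q + + 4) + (+ 1644 + (q - + 8) * (+ 445 + (q - + 8) * + 30))
    identity = solve-∀
  256f≡w : + 256 * f ≡ w
  256f≡w = identity q s
    where
    identity : ∀ q s → + 256 * (+ 4 * (s * s) - (+ 2 * (q * q) + + 4 * q) * s + (+ 4 * (q * q) - q * (q * q) - (q * q) * (q * q)))
      ≡ + 63888 + ((q - + 8) * (+ 97784 + (q - + 8) * (+ 31929 + (q - + 8) * (+ 3900 + (q - + 8) * + 164)))
        + ((+ 32 * s - (+ 30 * (q * q) - + 3 * q + + 4)) * (+ 2520 + (q - + 8) * (+ 666 + (q - + 8) * + 44))
        + (+ 32 * s - (+ 30 * (q * q) - + 3 * q + + 4)) * (+ 32 * s - (+ 30 * (q * q) - + 3 * q + + 4))))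
    identity = solve-∀

  0<s-q : 0ℤ ℤ.< s - q
  0<s-q = ℤP.*-cancelˡ-<-nonNeg (+ 32) (ℤP.<-≤-trans (ℤP.suc[i]≤j⇒i<j 1≤g) (ℤP.≤-reflexive (sym 32[s-q]≡g)))
  0<f : 0ℤ ℤ.< f
  0<f = ℤP.*-cancelˡ-<-nonNeg (+ 256) (ℤP.<-≤-trans (ℤP.suc[i]≤j⇒i<j 1≤w) (ℤP.≤-reflexive (sym 256f≡w)))
    where
    v : ℤ
    v = r * (+ 97784 + r * (+ 31929 + r * (+ 3900 + r * + 164))) + (u * (+ 2520 + r * (+ 666 + r * + 44)) + u * u)
    0≤v : 0ℤ ≤ v
    0≤v = 0≤+ (0≤* 0≤r (0≤+ 0≤+ₙ (0≤* 0≤r (0≤+ 0≤+ₙ (0≤* 0≤r (0≤+ 0≤+ₙ (0≤* 0≤r 0≤+ₙ)))))))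
      (0≤+ (0≤* 0≤u (0≤+ 0≤+ₙ (0≤* 0≤r (0≤+ 0≤+ₙ (0≤* 0≤r 0≤+ₙ))))) (0≤square u))
    1≤w : 1ℤ ≤ w
    1≤w = ≤-by (+ 63887 + v) (0≤+ 0≤+ₙ 0≤v) (sym (ℤP.+-assoc 1ℤ (+ 63887) v))
  0<q : 0ℤ ℤ.< q
  0<q = ℤP.<-≤-trans (+<+ ℕ.z<s) 8≤q
  0<s : 0ℤ ℤ.< s
  0<s = subst (0ℤ ℤ.<_) (restore s q) (ℤP.+-mono-< 0<s-q 0<q)
    where
    restore : ∀ s q → s - q + q ≡ s
    restore = solve-∀
  0<E : 0ℤ ℤ.< E
  0<E = ℤP.<-≤-trans (0<* 0<s 0<s-q) E≥
  0<qEf : 0ℤ ℤ.< q * E * f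
  0<qEf = 0<* (0<* 0<q 0<E) 0<f
  0≤-qEf : 0ℤ ≤ - (q * E * f)
  0≤-qEf = subst (0ℤ ≤_) (balance q s C T E)
    (0≤+ (0≤* (0≤+ₙ {2}) (ℤP.i≤j⇒0≤j-i third))
      (0≤+ (0≤* (0≤* (0≤+ₙ {2}) (ℤP.<⇒≤ 0<q)) (ℤP.i≤j⇒0≤j-i (C≥ (ℤP.<⇒≤ 0<s-q)))) (ℤP.i≤j⇒0≤j-i T≤)))
    where
    balance : ∀ q s C T E →
      + 2 * (T + q * (q * (q * (s * E))) - q * C)
        + (+ 2 * q * (C - (+ 2 * s - q) * (s - q) * E) + ((q * (q * q + q - + 2) - + 2 * s) * (q * (q * E)) - + 2 * T))
      ≡ - (q * E * (+ 4 * (s * s) - (+ 2 * (q * q) + + 4 * q) * s + (+ 4 * (q * q) - q * (q * q) - (q * q) * (q * q))))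
    balance = solve-∀

-- Here E ≥ 192 and C ≥ 336 E, so the third moment gives 320 E ≤ T ≤ 30720, while 320 · 192 = 61440.
-- The bound on T comes from the quadratic interpolating the cube of the deviation at n = 1, 2, 9.
16-contradiction : ∀ q s C T E → q ≡ + 4 → s ≡ + 16 →
  s * (s - q) ≤ E → (+ 2 * s - q) * (s - q) * E ≤ C → T ≤ q * (q * + 1920) →
  q * C ≤ T + q * (q * (q * (s * E))) → ⊥
16-contradiction q s C T E refl refl E≥ C≥ T≤ third = absurd (subst (0ℤ ≤_) (balance C T E)
  (0≤+ (ℤP.i≤j⇒0≤j-i third) (0≤+ (0≤* (0≤+ₙ {4}) (ℤP.i≤j⇒0≤j-i C≥))
    (0≤+ (ℤP.i≤j⇒0≤j-i T≤) (0≤* (0≤+ₙ {320}) (ℤP.i≤j⇒0≤j-i E≥))))))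
  where
  balance : ∀ C T E →
    T + + 4 * (+ 4 * (+ 4 * (+ 16 * E))) - + 4 * C
      + (+ 4 * (C - + 336 * E) + (+ 30720 - T + + 320 * (E - + 192))) ≡ - + 30720
  balance = solve-∀
  absurd : ¬ 0ℤ ≤ - + 30720
  absurd ()

-- The hypotheses combine to 1960 E ≤ 326832, while 1960 · 171 = 335160. From E ≥ 171 the mean of D
-- over the 15 members is at least 15 + 171 / 15 = 26.4, which is why C is bounded by a chord
-- between 26 and 27.
15-contradiction : ∀ q s C T E → q ≡ + 4 → s ≡ + 15 →
  + 171 ≤ E → + 742 * E + s * (- + 5016) ≤ C → T ≤ + 3 * (q * (q * E)) + q * (q * + 1617) →
  q * C ≤ T + q * (q * (q * (s * E))) → ⊥
15-contradiction q s C T E refl refl E≥ C≥ T≤ third = absurd (subst (0ℤ ≤_) (balance C T E)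
  (0≤+ (ℤP.i≤j⇒0≤j-i third) (0≤+ (0≤* (0≤+ₙ {4}) (ℤP.i≤j⇒0≤j-i C≥))
    (0≤+ (ℤP.i≤j⇒0≤j-i T≤) (0≤* (0≤+ₙ {1960}) (ℤP.i≤j⇒0≤j-i E≥))))))
  where
  balance : ∀ C T E →
    T + + 4 * (+ 4 * (+ 4 * (+ 15 * E))) - + 4 * C
      + (+ 4 * (C - (+ 742 * E + - + 75240)) + (+ 3 * (+ 4 * (+ 4 * E)) + + 25872 - T + + 1960 * (E - + 171))) ≡ - + 8328
  balance = solve-∀
  absurd : ¬ 0ℤ ≤ - + 8328
  absurd ()
-- For q = 4 the size condition reads 32 s ≥ 472, which 14 members (448) fail, and s ≤ q² = 16.
15⊎16 : ∀ {k n} → + k ≡ + 4 → 0ℤ ≤ + 32 * + n - (+ 30 * (+ k * + k) - + 3 * + k + + 4) → + n ≤ + k * + k →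
  + n ≡ + 15 ⊎ + n ≡ + 16
15⊎16 {n = n} refl large n≤ with ℕP.m≤n⇒m<n∨m≡n (ℤP.drop‿+≤+ n≤)
... | inj₂ refl = inj₂ refl
... | inj₁ (ℕ.s≤s n≤15) with ℕP.m≤n⇒m<n∨m≡n n≤15
...   | inj₂ refl = inj₁ refl
...   | inj₁ (ℕ.s≤s n≤14) = contradiction
        (ℤP.≤-trans (ℤP.0≤i-j⇒j≤i large) (ℤP.*-monoˡ-≤-nonNeg (+ 32) (+≤+ n≤14)))
        (from-no (+ 472 ℤP.≤? + 448))

-- Incidences in an intersecting family.

module IntersectingFamily {q : ℕ} {_⊕_ _⊗_ : Op₂ (Fin q)} {⊖_ : Op₁ (Fin q)} {0K 1K : Fin q}
  (isCommutativeRing : IsCommutativeRing _≡_ _⊕_ _⊗_ ⊖_ 0K 1K)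
  (1⊕1≡0 : 1K ⊕ 1K ≡ 0K)
  (inverse : ∀ x → x ≢ 0K → ∃[ y ] y ⊗ x ≡ 1K)
  where

  open FiniteFieldOfCharacteristic2 isCommutativeRing 1⊕1≡0 inverse public

  lead lin : Quadratic → Fin q
  lead = proj₁
  lin  = proj₁ ∘ proj₂

  _≟ᴾ_ : DecidableEquality Quadratic
  _≟ᴾ_ = ≡-dec _≟_ (≡-dec _≟_ _≟_)

  module _ {S : List Quadratic} (S! : Uniqueₚ S)
    (meet : ∀ {f h} → f ∈ₚ S → h ∈ₚ S → ∃[ x ] value x f ≡ value x h) where

    s : ℤ
    s = + length S

    fibre : (Quadratic → Fin q) → Fin q → ℤ
    fibre κ k = ∑ S (λ h → 𝟙 (κ h ≟ k))

    through : Fin q → Fin q → ℤ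
    through x = fibre (value x)

    common : Quadratic → Quadratic → ℤ
    common f h = ∑ꟳ (λ x → 𝟙 (value x h ≟ value x f))

    degree : Quadratic → ℤ
    degree f = ∑ꟳ (λ x → through x (value x f))

    sameLead sameLin : Fin q → ℤ
    sameLead = fibre lead
    sameLin  = fibre lin

    degree-common : ∀ f → degree f ≡ ∑ S (common f)
    degree-common f = ∑-swap (allFin q) S (λ x h → 𝟙 (value x h ≟ value x f))

    -- Two such members differ by a constant, and the constant is zero because they meet.
    lead-lin-injective : ∀ {f h} → f ∈ₚ S → h ∈ₚ S → lead f ≡ lead h → lin f ≡ lin h → f ≡ h
    lead-lin-injective {a , b , c} {_ , _ , c′} f∈ h∈ refl refl with meet f∈ h∈
    ... | x , eq = cong (λ c → a , b , c) (begin
      c              ≡⟨ solve 2 (λ c k → c := (c :+ k) :+ k) refl c k ⟩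
      (c ⊕ k) ⊕ k    ≡⟨ cong (_⊕ k) eq ⟩
      (c′ ⊕ k) ⊕ k   ≡⟨ solve 2 (λ c k → (c :+ k) :+ k := c) refl c′ k ⟩
      c′             ∎)
      where
      open ≡-Reasoning
      k = x ⊗ (b ⊕ (x ⊗ a))

    -- Within one class of κ the members are told apart by λ′, which has q possible values.
    class≤q : ∀ (κ λ′ : Quadratic → Fin q) →
      (∀ {f h} → f ∈ₚ S → h ∈ₚ S → κ f ≡ κ h → λ′ f ≡ λ′ h → f ≡ h) →
      ∀ k → ∑ S (λ h → 𝟙 (κ h ≟ k)) ≤ + q
    class≤q κ λ′ inj k = begin
      ∑ S (λ h → 𝟙 (κ h ≟ k))                     ≡⟨ ∑-cong S split ⟩
      ∑ S (λ h → ∑ꟳ (λ l → 𝟙 (both? l h)))        ≡⟨ ∑-swap S (allFin q) (λ h l → 𝟙 (both? l h)) ⟩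
      ∑ꟳ (λ l → ∑ S (λ h → 𝟙 (both? l h)))        ≤⟨ ∑-mono (allFin q) (λ l → ∑-𝟙≤1 (both? l) S!
                                                       λ { f∈ h∈ (κf , λf) (κh , λh) → inj f∈ h∈ (trans κf (sym κh)) (trans λf (sym λh)) }) ⟩
      ∑ꟳ {q} (λ _ → 1ℤ)                           ≡⟨ trans (∑ꟳ-const {q} 1ℤ) (ℤP.*-identityʳ (+ q)) ⟩
      + q                                         ∎
      where
      open ℤP.≤-Reasoning
      both? : ∀ l h → Dec (κ h ≡ k × λ′ h ≡ l)
      both? l h = (κ h ≟ k) ×-dec (λ′ h ≟ l)
      split : ∀ h → 𝟙 (κ h ≟ k) ≡ ∑ꟳ (λ l → 𝟙 (both? l h))
      split h = sym (trans (∑ꟳ-single (λ′ h) (λ l l≢ → 𝟙-no (both? l h) (λ { (_ , eq) → l≢ (sym eq) })))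
        (𝟙-⇔ (both? (λ′ h) h) (κ h ≟ k) proj₁ (_, refl)))

    sameLead≤q : ∀ a → sameLead a ≤ + q
    sameLead≤q = class≤q lead lin lead-lin-injective

    sameLin≤q : ∀ b → sameLin b ≤ + q
    sameLin≤q = class≤q lin lead (λ f∈ h∈ lin≡ lead≡ → lead-lin-injective f∈ h∈ lead≡ lin≡)

    length≤common : ∀ {xs f h} → Uniqueₚ xs → (∀ {x} → x ∈ₚ xs → value x h ≡ value x f) → + length xs ≤ common f h
    length≤common {xs} {f} {h} xs! agree = begin
      + length xs                              ≡⟨ ℤP.*-identityʳ _ ⟨
      + length xs * 1ℤ                         ≡⟨ ∑-const xs 1ℤ ⟨
      ∑ xs (λ _ → 1ℤ)                          ≡⟨ ∑-cong-∈ xs (λ x∈ → 𝟙-yes (_ ≟ _) (agree x∈)) ⟨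
      ∑ xs (λ x → 𝟙 (value x h ≟ value x f))   ≤⟨ ∑-⊆ xs! (λ {x} _ → ∈-allFin x) (λ x → 0≤𝟙 (_ ≟ _)) ⟩
      common f h                               ∎
      where open ℤP.≤-Reasoning

    common-self : ∀ f → common f f ≡ + q
    common-self f = trans (∑-cong (allFin q) (λ x → 𝟙-yes (value x f ≟ value x f) refl))
      (trans (∑ꟳ-const {q} 1ℤ) (ℤP.*-identityʳ (+ q)))

    -- The roots of αX² + βX + γ add up to β / α, so they differ when β ≠ 0.
    second-point : ∀ {f h x} → lead h ≢ lead f → lin h ≢ lin f → value x h ≡ value x f →
      ∃[ x′ ] x′ ≢ x × value x′ h ≡ value x′ f
    second-point {a , b , c} {a′ , b′ , c′} {x} a′≢a b′≢b eq with inverse (a′ ⊕ a) (a′≢a ∘ ⊕≡0⇒≡)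
    ... | u , u⊗α≡1 = x ⊕ w , distinct , agree
      where
      open ≡-Reasoning
      α = a′ ⊕ a
      β = b′ ⊕ b
      w = u ⊗ β
      α⊗w≡β : α ⊗ w ≡ β
      α⊗w≡β = begin
        α ⊗ (u ⊗ β)  ≡⟨ solve 3 (λ α u β → α :* (u :* β) := (u :* α) :* β) refl α u β ⟩
        (u ⊗ α) ⊗ β  ≡⟨ cong (_⊗ β) u⊗α≡1 ⟩
        1K ⊗ β       ≡⟨ solve 1 (λ β → con true :* β := β) refl β ⟩
        β            ∎
      distinct : x ⊕ w ≢ x
      distinct x⊕w≡x = b′≢b (⊕≡0⇒≡ (begin
        β                  ≡⟨ α⊗w≡β ⟨
        α ⊗ w              ≡⟨ solve 3 (λ α w x → α :* w := α :* ((x :+ w) :+ x)) refl α w x ⟩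
        α ⊗ ((x ⊕ w) ⊕ x)  ≡⟨ cong (λ z → α ⊗ (z ⊕ x)) x⊕w≡x ⟩
        α ⊗ (x ⊕ x)        ≡⟨ solve 2 (λ α x → α :* (x :+ x) := con false) refl α x ⟩
        0K                 ∎))
      agree : value (x ⊕ w) (a′ , b′ , c′) ≡ value (x ⊕ w) (a , b , c)
      agree = ⊕≡0⇒≡ (begin
        value (x ⊕ w) (a′ , b′ , c′) ⊕ value (x ⊕ w) (a , b , c)
          ≡⟨ solve 8 (λ a b c a′ b′ c′ x w →
               (c′ :+ (x :+ w) :* (b′ :+ (x :+ w) :* a′)) :+ (c :+ (x :+ w) :* (b :+ (x :+ w) :* a))
               := ((c′ :+ x :* (b′ :+ x :* a′)) :+ (c :+ x :* (b :+ x :* a)))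
                  :+ w :* ((a′ :+ a) :* w :+ (b′ :+ b)))
               refl a b c a′ b′ c′ x w ⟩
        (value x (a′ , b′ , c′) ⊕ value x (a , b , c)) ⊕ (w ⊗ ((α ⊗ w) ⊕ β))
          ≡⟨ cong₂ (λ y z → (y ⊕ value x (a , b , c)) ⊕ (w ⊗ (z ⊕ β))) eq α⊗w≡β ⟩
        (value x (a , b , c) ⊕ value x (a , b , c)) ⊕ (w ⊗ (β ⊕ β))
          ≡⟨ solve 3 (λ y w β → (y :+ y) :+ w :* (β :+ β) := con false) refl (value x (a , b , c)) w β ⟩
        0K ∎)

    -- A coinciding coefficient may cost one of the two common points, and its indicator pays for
    -- it. For h = f both sides equal q + 2, so the inequality can be summed over all of S without
    -- excluding f.
    2≤common : ∀ {f h} → f ∈ₚ S → h ∈ₚ S →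
      (same? : Dec (h ≡ f)) (sameLead? : Dec (lead h ≡ lead f)) (sameLin? : Dec (lin h ≡ lin f)) →
      + 2 + + q * 𝟙 same? ≤ common f h + (𝟙 sameLead? + 𝟙 sameLin?)
    2≤common {f} f∈ h∈ (yes refl) (yes _) (yes _) = ℤP.≤-reflexive (begin
      + 2 + + q * 1ℤ     ≡⟨ rearrange (+ q) ⟩
      + q + + 2          ≡⟨ cong (_+ + 2) (common-self f) ⟨
      common f f + + 2   ∎)
      where
      open ≡-Reasoning
      rearrange : ∀ q → + 2 + q * 1ℤ ≡ q + + 2
      rearrange = solve-∀
    2≤common f∈ h∈ (yes refl) (no a≢) _       = contradiction refl a≢
    2≤common f∈ h∈ (yes refl) (yes _) (no b≢) = contradiction refl b≢
    2≤common f∈ h∈ (no h≢f) (yes a≡) (yes b≡) = contradiction (lead-lin-injective h∈ f∈ a≡ b≡) h≢f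
    2≤common {f} {h} f∈ h∈ (no _) (yes _) (no _) =
      let x , eq = meet h∈ f∈ in ≤-by (common f h - + 1)
            (ℤP.i≤j⇒0≤j-i (length≤common {x ∷ []} {f} {h} ([] ∷ []) λ { (here refl) → eq }))
            (balance (+ q) (common f h))
      where
      balance : ∀ q c → + 2 + q * 0ℤ + (c - + 1) ≡ c + (1ℤ + 0ℤ)
      balance = solve-∀
    2≤common {f} {h} f∈ h∈ (no _) (no _) (yes _) =
      let x , eq = meet h∈ f∈ in ≤-by (common f h - + 1)
            (ℤP.i≤j⇒0≤j-i (length≤common {x ∷ []} {f} {h} ([] ∷ []) λ { (here refl) → eq }))
            (balance (+ q) (common f h))
      where
      balance : ∀ q c → + 2 + q * 0ℤ + (c - + 1) ≡ c + (0ℤ + 1ℤ)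
      balance = solve-∀
    2≤common {f} {h} f∈ h∈ (no _) (no a≢) (no b≢) =
      let x , eq = meet h∈ f∈ ; x′ , x′≢x , eq′ = second-point {f} {h} a≢ b≢ eq in ≤-by (common f h - + 2)
            (ℤP.i≤j⇒0≤j-i (length≤common {x′ ∷ x ∷ []} {f} {h} ((x′≢x ∷ []) ∷ [] ∷ [])
              λ { (here refl) → eq′ ; (there (here refl)) → eq }))
            (balance (+ q) (common f h))
      where
      balance : ∀ q c → + 2 + q * 0ℤ + (c - + 2) ≡ c + (0ℤ + 0ℤ)
      balance = solve-∀

    ∑ₛ-𝟙 : ∀ {f} → f ∈ₚ S → ∑ S (λ h → 𝟙 (h ≟ᴾ f)) ≡ 1ℤ
    ∑ₛ-𝟙 {f} f∈ = trans (∑-single S! f∈ (λ h h≢f → 𝟙-no (h ≟ᴾ f) h≢f)) (𝟙-yes (f ≟ᴾ f) refl)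

    -- The two class sizes are kept here: bounding each by q gives D ≥ 2s - q, but for 15 members
    -- over the field of 4 elements their sum over S has to be estimated more sharply.
    degree-≥ : ∀ {f} → f ∈ₚ S → + 2 * s + + q ≤ degree f + (sameLead (lead f) + sameLin (lin f))
    degree-≥ {f} f∈ = begin
      + 2 * s + + q                                ≡⟨ cong₂ _+_ (ℤP.*-comm (+ 2) s) (sym (ℤP.*-identityʳ (+ q))) ⟩
      s * + 2 + + q * 1ℤ                           ≡⟨ cong₂ _+_ (∑-const S (+ 2)) (cong (+ q *_) (∑ₛ-𝟙 f∈)) ⟨
      ∑ S (λ _ → + 2) + + q * ∑ S same             ≡⟨ cong (λ z → ∑ S (λ _ → + 2) + z) (∑-* S (+ q) same) ⟨
      ∑ S (λ _ → + 2) + ∑ S (λ h → + q * same h)   ≡⟨ ∑-+ S (λ _ → + 2) (λ h → + q * same h) ⟨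
      ∑ S (λ h → + 2 + + q * same h)               ≤⟨ ∑-mono-∈ S (λ {h} h∈ → 2≤common f∈ h∈ (h ≟ᴾ f) (_ ≟ _) (_ ≟ _)) ⟩
      ∑ S (λ h → common f h + (eqLead h + eqLin h)) ≡⟨ ∑-+ S (common f) (λ h → eqLead h + eqLin h) ⟩
      ∑ S (common f) + ∑ S (λ h → eqLead h + eqLin h) ≡⟨ cong₂ _+_ (sym (degree-common f)) (∑-+ S eqLead eqLin) ⟩
      degree f + (sameLead (lead f) + sameLin (lin f)) ∎
      where
      open ℤP.≤-Reasoning
      same eqLead eqLin : Quadratic → ℤ
      same h = 𝟙 (h ≟ᴾ f)
      eqLead h = 𝟙 (lead h ≟ lead f)
      eqLin h = 𝟙 (lin h ≟ lin f)

    2s-q≤degree : ∀ {f} → f ∈ₚ S → + 2 * s - + q ≤ degree f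
    2s-q≤degree {f} f∈ = ≤-by _
      (0≤+ (ℤP.i≤j⇒0≤j-i (degree-≥ f∈)) (0≤+ (ℤP.i≤j⇒0≤j-i (sameLead≤q (lead f))) (ℤP.i≤j⇒0≤j-i (sameLin≤q (lin f)))))
      (rearrange s (+ q) (degree f) (sameLead (lead f)) (sameLin (lin f)))
      where
      rearrange : ∀ s q d a b → + 2 * s - q + (d + (a + b) - (+ 2 * s + q) + (q - a + (q - b))) ≡ d
      rearrange = solve-∀

    -- Members through (x₀ , y₀) meet f only at the other q - 1 abscissae, and there
    -- are q quadratics through (x₀ , y₀) and a given point of f over each of those.
    through-missed : ∀ {f x₀ y₀} → f ∈ₚ S → value x₀ f ≢ y₀ → + 2 * through x₀ y₀ + + 2 ≤ + q * + q + + q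
    through-missed {f} {x₀} {y₀} f∈ f∌ = ≤-by _
      (0≤+ (ℤP.i≤j⇒0≤j-i doubled) (0≤+ (ℤP.i≤j⇒0≤j-i incidences) (0≤+
        (ℤP.i≤j⇒0≤j-i (disjoint eqLead (λ h → 0≤𝟙 (_ ≟ _)) (𝟙-yes (_ ≟ _) refl) (λ h → 𝟙≤1 (_ ≟ _)) (sameLead≤q (lead f))))
        (ℤP.i≤j⇒0≤j-i (disjoint eqLin  (λ h → 0≤𝟙 (_ ≟ _)) (𝟙-yes (_ ≟ _) refl) (λ h → 𝟙≤1 (_ ≟ _)) (sameLin≤q (lin f)))))))
      (rearrange (through x₀ y₀) (∑ S (λ h → at h * common f h)) (∑ S (λ h → at h * eqLead h)) (∑ S (λ h → at h * eqLin h)) (+ q))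
      where
      open ℤP.≤-Reasoning
      at eqLead eqLin : Quadratic → ℤ
      at h = 𝟙 (value x₀ h ≟ y₀)
      eqLead h = 𝟙 (lead h ≟ lead f)
      eqLin h = 𝟙 (lin h ≟ lin f)

      𝟙≤1 : ∀ {A : Set} (d : Dec A) → 𝟙 d ≤ 1ℤ
      𝟙≤1 (yes _) = ℤP.≤-refl
      𝟙≤1 (no  _) = +≤+ z≤n

      rearrange : ∀ n c a b q →
        + 2 * n + + 2 + ((c + (a + b) - + 2 * n) + (q * q - q - c + ((q - (a + 1ℤ)) + (q - (b + 1ℤ))))) ≡ q * q + q
      rearrange = solve-∀

      doubled : + 2 * through x₀ y₀ ≤ ∑ S (λ h → at h * common f h) + (∑ S (λ h → at h * eqLead h) + ∑ S (λ h → at h * eqLin h))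
      doubled = begin
        + 2 * through x₀ y₀                        ≡⟨ ∑-* S (+ 2) at ⟨
        ∑ S (λ h → + 2 * at h)                     ≤⟨ ∑-mono-∈ S pointwise ⟩
        ∑ S (λ h → at h * common f h + (at h * eqLead h + at h * eqLin h))
          ≡⟨ ∑-+ S (λ h → at h * common f h) (λ h → at h * eqLead h + at h * eqLin h) ⟩
        ∑ S (λ h → at h * common f h) + ∑ S (λ h → at h * eqLead h + at h * eqLin h)
          ≡⟨ cong (λ z → ∑ S (λ h → at h * common f h) + z) (∑-+ S (λ h → at h * eqLead h) (λ h → at h * eqLin h)) ⟩
        ∑ S (λ h → at h * common f h) + (∑ S (λ h → at h * eqLead h) + ∑ S (λ h → at h * eqLin h)) ∎
        where
        pointwise : ∀ {h} → h ∈ₚ S → + 2 * at h ≤ at h * common f h + (at h * eqLead h + at h * eqLin h)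
        pointwise {h} h∈ = ≤-by _
          (0≤+ (0≤* (0≤𝟙 (value x₀ h ≟ y₀)) (ℤP.i≤j⇒0≤j-i (2≤common f∈ h∈ (h ≟ᴾ f) (_ ≟ _) (_ ≟ _))))
               (0≤* (0≤𝟙 (value x₀ h ≟ y₀)) (0≤* (0≤+ₙ {q}) (0≤𝟙 (h ≟ᴾ f)))))
          (identity (at h) (common f h) (eqLead h) (eqLin h) (+ q * 𝟙 (h ≟ᴾ f)))
          where
          identity : ∀ t c a b e → + 2 * t + (t * (c + (a + b) - (+ 2 + e)) + t * e) ≡ t * c + (t * a + t * b)
          identity = solve-∀

      incidences : ∑ S (λ h → at h * common f h) ≤ + q * + q - + q
      incidences = begin
        ∑ S (λ h → at h * common f h)
          ≡⟨ ∑-cong S (λ h → ∑-* (allFin q) (at h) (λ x → 𝟙 (value x h ≟ value x f))) ⟨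
        ∑ S (λ h → ∑ꟳ (λ x → at h * 𝟙 (value x h ≟ value x f)))
          ≡⟨ ∑-swap S (allFin q) (λ h x → at h * 𝟙 (value x h ≟ value x f)) ⟩
        ∑ꟳ (λ x → ∑ S (λ h → at h * 𝟙 (value x h ≟ value x f)))
          ≤⟨ ∑-mono (allFin q) bound ⟩
        -- The bound is 0 over x₀, where f disagrees with every quadratic through (x₀ , y₀), and q
        -- over each other abscissa.
        ∑ꟳ (λ x → + q + - + q * 𝟙 (x₀ ≟ x))
          ≡⟨ ∑-+ (allFin q) (λ _ → + q) (λ x → - + q * 𝟙 (x₀ ≟ x)) ⟩
        ∑ꟳ {q} (λ _ → + q) + ∑ꟳ (λ x → - + q * 𝟙 (x₀ ≟ x))
          ≡⟨ cong₂ _+_ (∑ꟳ-const {q} (+ q)) (trans (∑-* (allFin q) (- + q) (λ x → 𝟙 (x₀ ≟ x))) (cong (- + q *_) (∑ꟳ-𝟙 x₀))) ⟩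
        + q * + q + - + q * 1ℤ
          ≡⟨ cong (λ z → + q * + q + z) (ℤP.*-identityʳ (- + q)) ⟩
        + q * + q - + q ∎
        where
        bound : ∀ x → ∑ S (λ h → at h * 𝟙 (value x h ≟ value x f)) ≤ + q + - + q * 𝟙 (x₀ ≟ x)
        bound x with x₀ ≟ x
        ... | yes refl = ℤP.≤-reflexive (trans (∑-zero S avoid) (cancel (+ q)))
          where
          cancel : ∀ q → 0ℤ ≡ q + - q * 1ℤ
          cancel = solve-∀
          avoid : ∀ h → at h * 𝟙 (value x₀ h ≟ value x₀ f) ≡ 0ℤ
          avoid h with value x₀ h ≟ y₀
          ... | no _  = ℤP.*-zeroˡ (𝟙 (value x₀ h ≟ value x₀ f))
          ... | yes p = trans (ℤP.*-identityˡ (𝟙 (value x₀ h ≟ value x₀ f))) (𝟙-no (_ ≟ _) (λ r → f∌ (trans (sym r) p)))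
        ... | no x₀≢x = begin
          ∑ S ψ               ≤⟨ ∑-⊆ S! (λ {h} _ → ∈-quadratics h) (λ h → 0≤* (0≤𝟙 (value x₀ h ≟ y₀)) (0≤𝟙 (value x h ≟ value x f))) ⟩
          ∑ᴾ ψ                ≡⟨ ∑ᴾ-through-two-points (≢-sym x₀≢x) y₀ (value x f) ⟩
          + q                 ≡⟨ pad (+ q) ⟩
          + q + - + q * 0ℤ    ∎
          where
          ψ : Quadratic → ℤ
          ψ h = at h * 𝟙 (value x h ≟ value x f)
          pad : ∀ q → q ≡ q + - q * 0ℤ
          pad = solve-∀

      -- The member f takes one of the at most q places in its own class but misses (x₀ , y₀), which
      -- leaves at most q - 1 for members through that point.
      disjoint : ∀ (ψ : Quadratic → ℤ) → (∀ h → 0ℤ ≤ ψ h) → ψ f ≡ 1ℤ → (∀ h → ψ h ≤ 1ℤ) → ∑ S ψ ≤ + q →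
        ∑ S (λ h → at h * ψ h) + 1ℤ ≤ + q
      disjoint ψ 0≤ψ ψf≡1 ψ≤1 ∑ψ≤q = begin
        ∑ S (λ h → at h * ψ h) + 1ℤ                         ≡⟨ cong (λ z → ∑ S (λ h → at h * ψ h) + z) (∑ₛ-𝟙 f∈) ⟨
        ∑ S (λ h → at h * ψ h) + ∑ S (λ h → 𝟙 (h ≟ᴾ f))     ≡⟨ ∑-+ S (λ h → at h * ψ h) (λ h → 𝟙 (h ≟ᴾ f)) ⟨
        ∑ S (λ h → at h * ψ h + 𝟙 (h ≟ᴾ f))                 ≤⟨ ∑-mono S pointwise ⟩
        ∑ S ψ                                               ≤⟨ ∑ψ≤q ⟩
        + q                                                 ∎
        where
        pointwise : ∀ h → at h * ψ h + 𝟙 (h ≟ᴾ f) ≤ ψ h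
        pointwise h with value x₀ h ≟ y₀ | h ≟ᴾ f
        ... | yes p | yes refl = contradiction p f∌
        ... | yes _ | no _     = ℤP.≤-reflexive (unit (ψ h))
          where
          unit : ∀ k → 1ℤ * k + 0ℤ ≡ k
          unit = solve-∀
        ... | no _  | yes refl = ℤP.≤-reflexive (trans (cong (_+ 1ℤ) (ℤP.*-zeroˡ (ψ f))) (sym ψf≡1))
        ... | no _  | no _     = subst (_≤ ψ h) (sym (cong (_+ 0ℤ) (ℤP.*-zeroˡ (ψ h)))) (0≤ψ h)

    -- Deviations and their second and third moments.

    ∑-fibre : ∀ κ (φ : Fin q → ℤ) → ∑ꟳ (λ k → fibre κ k * φ k) ≡ ∑ S (φ ∘ κ)
    ∑-fibre κ φ = begin
      ∑ꟳ (λ k → fibre κ k * φ k)                   ≡⟨ ∑-cong (allFin q) expand ⟩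
      ∑ꟳ (λ k → ∑ S (λ h → 𝟙 (κ h ≟ k) * φ k))     ≡⟨ ∑-swap (allFin q) S (λ k h → 𝟙 (κ h ≟ k) * φ k) ⟩
      ∑ S (λ h → ∑ꟳ (λ k → 𝟙 (κ h ≟ k) * φ k))     ≡⟨ ∑-cong S (λ h → ∑ꟳ-sift (κ h) φ) ⟩
      ∑ S (φ ∘ κ)                                  ∎
      where
      open ≡-Reasoning
      expand : ∀ k → fibre κ k * φ k ≡ ∑ S (λ h → 𝟙 (κ h ≟ k) * φ k)
      expand k = begin
        fibre κ k * φ k                      ≡⟨ ℤP.*-comm (fibre κ k) (φ k) ⟩
        φ k * fibre κ k                      ≡⟨ ∑-* S (φ k) (λ h → 𝟙 (κ h ≟ k)) ⟨
        ∑ S (λ h → φ k * 𝟙 (κ h ≟ k))        ≡⟨ ∑-cong S (λ h → ℤP.*-comm (φ k) (𝟙 (κ h ≟ k))) ⟩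
        ∑ S (λ h → 𝟙 (κ h ≟ k) * φ k)        ∎

    ∑-fibre-1 : ∀ κ → ∑ꟳ (fibre κ) ≡ s
    ∑-fibre-1 κ = begin
      ∑ꟳ (fibre κ)                   ≡⟨ ∑-cong (allFin q) (λ k → ℤP.*-identityʳ (fibre κ k)) ⟨
      ∑ꟳ (λ k → fibre κ k * 1ℤ)      ≡⟨ ∑-fibre κ (λ _ → 1ℤ) ⟩
      ∑ S (λ _ → 1ℤ)                 ≡⟨ ∑-const S 1ℤ ⟩
      s * 1ℤ                         ≡⟨ ℤP.*-identityʳ s ⟩
      s                              ∎
      where open ≡-Reasoning

    -- q times the deviation of through x y from its average s / q over y.
    dev : Fin q → Fin q → ℤ
    dev x y = + q * through x y - s

    ∑-dev : ∀ x → ∑ꟳ (dev x) ≡ 0ℤ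
    ∑-dev x = begin
      ∑ꟳ (dev x)
        ≡⟨ ∑-+ (allFin q) (λ y → + q * through x y) (λ _ → - s) ⟩
      ∑ꟳ (λ y → + q * through x y) + ∑ꟳ {q} (λ _ → - s)
        ≡⟨ cong₂ _+_ (∑-* (allFin q) (+ q) (through x)) (∑ꟳ-const {q} (- s)) ⟩
      + q * ∑ꟳ (through x) + + q * (- s)
        ≡⟨ cong (λ n → + q * n + + q * (- s)) (∑-fibre-1 (value x)) ⟩
      + q * s + + q * (- s)
        ≡⟨ cancel (+ q) s ⟩
      0ℤ ∎
      where
      open ≡-Reasoning
      cancel : ∀ q s → q * s + q * (- s) ≡ 0ℤ
      cancel = solve-∀

    ∑dev² ∑dev³ excess : ℤ
    ∑dev²  = ∑ꟳ (λ x → ∑ꟳ (λ y → dev x y * dev x y))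
    ∑dev³  = ∑ꟳ (λ x → ∑ꟳ (λ y → dev x y * (dev x y * dev x y)))
    excess = ∑ S (λ f → degree f - s)

    total : Quadratic → ℤ
    total f = ∑ꟳ (λ x → dev x (value x f))

    total-degree : ∀ f → total f ≡ + q * (degree f - s)
    total-degree f = begin
      total f
        ≡⟨ ∑-+ (allFin q) (λ x → + q * through x (value x f)) (λ _ → - s) ⟩
      ∑ꟳ (λ x → + q * through x (value x f)) + ∑ꟳ {q} (λ _ → - s)
        ≡⟨ cong₂ _+_ (∑-* (allFin q) (+ q) (λ x → through x (value x f))) (∑ꟳ-const {q} (- s)) ⟩
      + q * degree f + + q * (- s)
        ≡⟨ ℤP.*-distribˡ-+ (+ q) (degree f) (- s) ⟨
      + q * (degree f - s) ∎
      where open ≡-Reasoning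

    -- As `dev x` sums to zero over y, one of the two factors may be replaced by q n, and weighting
    -- by n turns the sum over y into a sum over the members.
    ∑dev²-excess : ∑dev² ≡ + q * (+ q * excess)
    ∑dev²-excess = begin
      ∑dev²
        ≡⟨ ∑-cong (allFin q) row ⟩
      ∑ꟳ (λ x → + q * ∑ S (λ h → dev x (value x h)))
        ≡⟨ ∑-* (allFin q) (+ q) (λ x → ∑ S (λ h → dev x (value x h))) ⟩
      + q * ∑ꟳ (λ x → ∑ S (λ h → dev x (value x h)))
        ≡⟨ cong (+ q *_) (∑-swap (allFin q) S (λ x h → dev x (value x h))) ⟩
      + q * ∑ S total
        ≡⟨ cong (+ q *_) (trans (∑-cong S total-degree) (∑-* S (+ q) (λ f → degree f - s))) ⟩
      + q * (+ q * excess) ∎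
      where
      open ≡-Reasoning
      row : ∀ x → ∑ꟳ (λ y → dev x y * dev x y) ≡ + q * ∑ S (λ h → dev x (value x h))
      row x = begin
        ∑ꟳ (λ y → dev x y * dev x y)
          ≡⟨ ∑-cong (allFin q) (λ y → split (+ q) (through x y) s) ⟩
        ∑ꟳ (λ y → + q * (through x y * dev x y) + - s * dev x y)
          ≡⟨ ∑-+ (allFin q) (λ y → + q * (through x y * dev x y)) (λ y → - s * dev x y) ⟩
        ∑ꟳ (λ y → + q * (through x y * dev x y)) + ∑ꟳ (λ y → - s * dev x y)
          ≡⟨ cong₂ _+_ (trans (∑-* (allFin q) (+ q) (λ y → through x y * dev x y)) (cong (+ q *_) (∑-fibre (value x) (dev x))))
                       (trans (∑-* (allFin q) (- s) (dev x)) (trans (cong (- s *_) (∑-dev x)) (ℤP.*-zeroʳ (- s)))) ⟩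
        + q * ∑ S (λ h → dev x (value x h)) + 0ℤ
          ≡⟨ ℤP.+-identityʳ _ ⟩
        + q * ∑ S (λ h → dev x (value x h)) ∎
        where
        split : ∀ q n s → (q * n - s) * (q * n - s) ≡ q * (n * (q * n - s)) + - s * (q * n - s)
        split = solve-∀

    private
      ∑-total : ∀ (φ : Quadratic → ℤ) → ∑ᴾ (λ f → total f * φ f) ≡ ∑ꟳ (λ x → ∑ᴾ (λ f → dev x (value x f) * φ f))
      ∑-total φ = trans (∑-cong quadratics expand) (∑-swap quadratics (allFin q) (λ f x → dev x (value x f) * φ f))
        where
        open ≡-Reasoning
        expand : ∀ f → total f * φ f ≡ ∑ꟳ (λ x → dev x (value x f) * φ f)
        expand f = begin
          total f * φ f                          ≡⟨ ℤP.*-comm (total f) (φ f) ⟩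
          φ f * total f                          ≡⟨ ∑-* (allFin q) (φ f) (λ x → dev x (value x f)) ⟨
          ∑ꟳ (λ x → φ f * dev x (value x f))     ≡⟨ ∑-cong (allFin q) (λ x → ℤP.*-comm (φ f) (dev x (value x f))) ⟩
          ∑ꟳ (λ x → dev x (value x f) * φ f)     ∎

      dev³ : Fin q → Fin q → Fin q → ℤ
      dev³ x₁ x₂ x₃ = ∑ᴾ (λ f → dev x₁ (value x₁ f) * (dev x₂ (value x₂ f) * dev x₃ (value x₃ f)))

      dev³-isolated : ∀ {x₁ x₂ x₃} → x₁ ≢ x₂ → x₁ ≢ x₃ → dev³ x₁ x₂ x₃ ≡ 0ℤ
      dev³-isolated {x₁} {x₂} {x₃} x₁≢x₂ x₁≢x₃ =
        ∑ᴾ-mean-zero x₁≢x₂ x₁≢x₃ (∑-dev x₁) (λ y₂ y₃ → dev x₂ y₂ * dev x₃ y₃)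

      dev³-rotate : ∀ x₁ x₂ x₃ → dev³ x₁ x₂ x₃ ≡ dev³ x₂ x₃ x₁
      dev³-rotate x₁ x₂ x₃ = ∑-cong quadratics (λ f →
        rotate (dev x₁ (value x₁ f)) (dev x₂ (value x₂ f)) (dev x₃ (value x₃ f)))
        where
        rotate : ∀ a b c → a * (b * c) ≡ b * (c * a)
        rotate = solve-∀

      -- One abscissa differs from both others, x₁ if x₁ ≠ x₃ and x₂ if x₁ = x₃, and its mean-zero
      -- factor kills the moment.
      dev³-off-diagonal₂ : ∀ x₁ {x₂} x₃ → x₂ ≢ x₁ → dev³ x₁ x₂ x₃ ≡ 0ℤ
      dev³-off-diagonal₂ x₁ {x₂} x₃ x₂≢x₁ with x₁ ≟ x₃
      ... | no x₁≢x₃ = dev³-isolated (≢-sym x₂≢x₁) x₁≢x₃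
      ... | yes refl = trans (dev³-rotate x₁ x₂ x₁) (dev³-isolated x₂≢x₁ x₂≢x₁)

      dev³-off-diagonal₃ : ∀ x₁ {x₃} → x₃ ≢ x₁ → dev³ x₁ x₁ x₃ ≡ 0ℤ
      dev³-off-diagonal₃ x₁ {x₃} x₃≢x₁ = trans (sym (dev³-rotate x₃ x₁ x₁)) (dev³-isolated x₃≢x₁ x₃≢x₁)

    ∑-total² : ∑ᴾ (λ f → total f * total f) ≡ + q * (+ q * ∑dev²)
    ∑-total² = begin
      ∑ᴾ (λ f → total f * total f)
        ≡⟨ ∑-total total ⟩
      ∑ꟳ (λ x₁ → ∑ᴾ (λ f → dev x₁ (value x₁ f) * total f))
        ≡⟨ ∑-cong (allFin q) row ⟩
      ∑ꟳ (λ x → + q * (+ q * ∑ꟳ (λ y → dev x y * dev x y)))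
        ≡⟨ ∑-* (allFin q) (+ q) (λ x → + q * ∑ꟳ (λ y → dev x y * dev x y)) ⟩
      + q * ∑ꟳ (λ x → + q * ∑ꟳ (λ y → dev x y * dev x y))
        ≡⟨ cong (+ q *_) (∑-* (allFin q) (+ q) (λ x → ∑ꟳ (λ y → dev x y * dev x y))) ⟩
      + q * (+ q * ∑dev²) ∎
      where
      open ≡-Reasoning
      row : ∀ x₁ → ∑ᴾ (λ f → dev x₁ (value x₁ f) * total f) ≡ + q * (+ q * ∑ꟳ (λ y → dev x₁ y * dev x₁ y))
      row x₁ = begin
        ∑ᴾ (λ f → dev x₁ (value x₁ f) * total f)
          ≡⟨ ∑-cong quadratics (λ f → ℤP.*-comm (dev x₁ (value x₁ f)) (total f)) ⟩
        ∑ᴾ (λ f → total f * dev x₁ (value x₁ f))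
          ≡⟨ ∑-total (λ f → dev x₁ (value x₁ f)) ⟩
        ∑ꟳ (λ x₂ → ∑ᴾ (λ f → dev x₂ (value x₂ f) * dev x₁ (value x₁ f)))
          -- Only two abscissae occur, so x₁ serves as both fixed points and its second value is
          -- ignored.
          ≡⟨ ∑ꟳ-single x₁ (λ x₂ x₂≢x₁ → ∑ᴾ-mean-zero x₂≢x₁ x₂≢x₁ (∑-dev x₂) (λ y _ → dev x₁ y)) ⟩
        ∑ᴾ (λ f → dev x₁ (value x₁ f) * dev x₁ (value x₁ f))
          ≡⟨ ∑ᴾ-value x₁ (λ y → dev x₁ y * dev x₁ y) ⟩
        + q * (+ q * ∑ꟳ (λ y → dev x₁ y * dev x₁ y)) ∎

    ∑-total³ : ∑ᴾ (λ f → total f * (total f * total f)) ≡ + q * (+ q * ∑dev³)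
    ∑-total³ = begin
      ∑ᴾ (λ f → total f * (total f * total f))
        ≡⟨ ∑-total (λ f → total f * total f) ⟩
      ∑ꟳ (λ x₁ → ∑ᴾ (λ f → dev x₁ (value x₁ f) * (total f * total f)))
        ≡⟨ ∑-cong (allFin q) row ⟩
      ∑ꟳ (λ x → + q * (+ q * ∑ꟳ (λ y → dev x y * (dev x y * dev x y))))
        ≡⟨ ∑-* (allFin q) (+ q) (λ x → + q * ∑ꟳ (λ y → dev x y * (dev x y * dev x y))) ⟩
      + q * ∑ꟳ (λ x → + q * ∑ꟳ (λ y → dev x y * (dev x y * dev x y)))
        ≡⟨ cong (+ q *_) (∑-* (allFin q) (+ q) (λ x → ∑ꟳ (λ y → dev x y * (dev x y * dev x y)))) ⟩
      + q * (+ q * ∑dev³) ∎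
      where
      open ≡-Reasoning
      front : ∀ a b c → a * (b * c) ≡ b * (a * c)
      front = solve-∀
      back : ∀ a b c → b * (a * c) ≡ c * (a * b)
      back = solve-∀
      unback : ∀ a b c → c * (a * b) ≡ a * (b * c)
      unback = solve-∀
      cell : ∀ x₁ x₂ → ∑ᴾ (λ f → dev x₂ (value x₂ f) * (dev x₁ (value x₁ f) * total f)) ≡ ∑ꟳ (dev³ x₁ x₂)
      cell x₁ x₂ = begin
        ∑ᴾ (λ f → dev x₂ (value x₂ f) * (dev x₁ (value x₁ f) * total f))
          ≡⟨ ∑-cong quadratics (λ f → back (dev x₁ (value x₁ f)) (dev x₂ (value x₂ f)) (total f)) ⟩
        ∑ᴾ (λ f → total f * (dev x₁ (value x₁ f) * dev x₂ (value x₂ f)))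
          ≡⟨ ∑-total (λ f → dev x₁ (value x₁ f) * dev x₂ (value x₂ f)) ⟩
        ∑ꟳ (λ x₃ → ∑ᴾ (λ f → dev x₃ (value x₃ f) * (dev x₁ (value x₁ f) * dev x₂ (value x₂ f))))
          ≡⟨ ∑-cong (allFin q) (λ x₃ → ∑-cong quadratics (λ f →
               unback (dev x₁ (value x₁ f)) (dev x₂ (value x₂ f)) (dev x₃ (value x₃ f)))) ⟩
        ∑ꟳ (dev³ x₁ x₂) ∎
      row : ∀ x₁ → ∑ᴾ (λ f → dev x₁ (value x₁ f) * (total f * total f))
                   ≡ + q * (+ q * ∑ꟳ (λ y → dev x₁ y * (dev x₁ y * dev x₁ y)))
      row x₁ = begin
        ∑ᴾ (λ f → dev x₁ (value x₁ f) * (total f * total f))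
          ≡⟨ ∑-cong quadratics (λ f → front (dev x₁ (value x₁ f)) (total f) (total f)) ⟩
        ∑ᴾ (λ f → total f * (dev x₁ (value x₁ f) * total f))
          ≡⟨ ∑-total (λ f → dev x₁ (value x₁ f) * total f) ⟩
        ∑ꟳ (λ x₂ → ∑ᴾ (λ f → dev x₂ (value x₂ f) * (dev x₁ (value x₁ f) * total f)))
          ≡⟨ ∑-cong (allFin q) (cell x₁) ⟩
        ∑ꟳ (λ x₂ → ∑ꟳ (dev³ x₁ x₂))
          ≡⟨ ∑ꟳ-single x₁ (λ x₂ x₂≢x₁ → ∑-zero (allFin q) (λ x₃ → dev³-off-diagonal₂ x₁ x₃ x₂≢x₁)) ⟩
        ∑ꟳ (dev³ x₁ x₁)
          ≡⟨ ∑ꟳ-single x₁ (λ x₃ → dev³-off-diagonal₃ x₁) ⟩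
        dev³ x₁ x₁ x₁
          ≡⟨ ∑ᴾ-value x₁ (λ y → dev x₁ y * (dev x₁ y * dev x₁ y)) ⟩
        + q * (+ q * ∑ꟳ (λ y → dev x₁ y * (dev x₁ y * dev x₁ y))) ∎

    0≤degree : ∀ f → 0ℤ ≤ degree f
    0≤degree f = ∑-nonneg (allFin q) (λ x → ∑-nonneg S (λ h → 0≤𝟙 (value x h ≟ value x f)))

    -- The members of S contribute at most as much as all quadratics to the sum of
    -- total² · degree, which the second and third moments evaluate.
    third-moment : + q * ∑ S (λ f → degree f * ((degree f - s) * (degree f - s))) ≤ ∑dev³ + + q * (+ q * (+ q * (s * excess)))
    third-moment = ℤP.*-cancelˡ-≤-pos _ _ (+ q) {{q>0}} (ℤP.*-cancelˡ-≤-pos _ _ (+ q) {{q>0}} (begin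
      + q * (+ q * (+ q * ∑ S cubic))
        ≡⟨ regroup (+ q) (∑ S cubic) ⟩
      (+ q * (+ q * + q)) * ∑ S cubic
        ≡⟨ ∑-* S (+ q * (+ q * + q)) cubic ⟨
      ∑ S (λ f → (+ q * (+ q * + q)) * cubic f)
        ≡⟨ ∑-cong S scaled ⟩
      ∑ S Φ
        ≤⟨ ∑-⊆ S! (λ {f} _ → ∈-quadratics f) 0≤Φ ⟩
      ∑ᴾ Φ
        ≡⟨ ∑-cong quadratics expand ⟩
      ∑ᴾ (λ f → total f * (total f * total f) + (+ q * s) * (total f * total f))
        ≡⟨ ∑-+ quadratics (λ f → total f * (total f * total f)) (λ f → (+ q * s) * (total f * total f)) ⟩
      ∑ᴾ (λ f → total f * (total f * total f)) + ∑ᴾ (λ f → (+ q * s) * (total f * total f))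
        ≡⟨ cong₂ _+_ ∑-total³ (trans (∑-* quadratics (+ q * s) (λ f → total f * total f)) (cong (+ q * s *_) ∑-total²)) ⟩
      + q * (+ q * ∑dev³) + (+ q * s) * (+ q * (+ q * ∑dev²))
        ≡⟨ cong (λ e → + q * (+ q * ∑dev³) + (+ q * s) * (+ q * (+ q * e))) ∑dev²-excess ⟩
      + q * (+ q * ∑dev³) + (+ q * s) * (+ q * (+ q * (+ q * (+ q * excess))))
        ≡⟨ collect (+ q) s ∑dev³ excess ⟩
      + q * (+ q * (∑dev³ + + q * (+ q * (+ q * (s * excess))))) ∎))
      where
      open ℤP.≤-Reasoning
      q>0 : Positive (+ q)
      q>0 = positive (ℤP.≤∧≢⇒< (0≤+ₙ {q}) (≢-sym q≢0))
      cubic Φ : Quadratic → ℤ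
      cubic f = degree f * ((degree f - s) * (degree f - s))
      Φ f = + q * degree f * (total f * total f)
      0≤Φ : ∀ f → 0ℤ ≤ Φ f
      0≤Φ f = 0≤* (0≤* (0≤+ₙ {q}) (0≤degree f)) (0≤square (total f))
      scaled : ∀ f → (+ q * (+ q * + q)) * cubic f ≡ Φ f
      scaled f = trans (shuffle (+ q) (degree f) (degree f - s))
        (cong (λ t → + q * degree f * (t * t)) (sym (total-degree f)))
        where
        shuffle : ∀ q d e → (q * (q * q)) * (d * (e * e)) ≡ q * d * ((q * e) * (q * e))
        shuffle = solve-∀
      expand : ∀ f → Φ f ≡ total f * (total f * total f) + (+ q * s) * (total f * total f)
      expand f = trans (cong (_* (total f * total f)) (trans (shift (+ q) (degree f) s) (cong (_+ + q * s) (sym (total-degree f)))))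
        (ℤP.*-distribʳ-+ (total f * total f) (total f) (+ q * s))
        where
        shift : ∀ q d s → q * d ≡ q * (d - s) + q * s
        shift = solve-∀
      regroup : ∀ q c → q * (q * (q * c)) ≡ (q * (q * q)) * c
      regroup = solve-∀
      collect : ∀ q s c e → q * (q * c) + (q * s) * (q * (q * (q * (q * e)))) ≡ q * (q * (c + q * (q * (q * (s * e)))))
      collect = solve-∀

    -- Turning pointwise estimates into bounds on the moments.

    -- A quadratic majorant of the cube suffices: its linear term sums to zero over every abscissa,
    -- and its square term is known from `excess`.
    ∑dev³-≤ : ∀ k c₂ c₁ c₀ →
      (∀ x y → k * (dev x y * (dev x y * dev x y)) ≤ c₂ * (dev x y * dev x y) + (c₁ * dev x y + c₀)) →
      k * ∑dev³ ≤ c₂ * (+ q * (+ q * excess)) + + q * (+ q * c₀)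
    ∑dev³-≤ k c₂ c₁ c₀ bound = begin
      k * ∑dev³
        ≡⟨ ∑-* (allFin q) k (λ x → ∑ꟳ (λ y → dev x y * (dev x y * dev x y))) ⟨
      ∑ꟳ (λ x → k * ∑ꟳ (λ y → dev x y * (dev x y * dev x y)))
        ≤⟨ ∑-mono (allFin q) row ⟩
      ∑ꟳ (λ x → c₂ * ∑ꟳ (λ y → dev x y * dev x y) + + q * c₀)
        ≡⟨ ∑-+ (allFin q) (λ x → c₂ * ∑ꟳ (λ y → dev x y * dev x y)) (λ _ → + q * c₀) ⟩
      ∑ꟳ (λ x → c₂ * ∑ꟳ (λ y → dev x y * dev x y)) + ∑ꟳ {q} (λ _ → + q * c₀)
        ≡⟨ cong₂ _+_ (trans (∑-* (allFin q) c₂ (λ x → ∑ꟳ (λ y → dev x y * dev x y))) (cong (c₂ *_) ∑dev²-excess))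
                     (∑ꟳ-const {q} (+ q * c₀)) ⟩
      c₂ * (+ q * (+ q * excess)) + + q * (+ q * c₀) ∎
      where
      open ℤP.≤-Reasoning
      row : ∀ x → k * ∑ꟳ (λ y → dev x y * (dev x y * dev x y)) ≤ c₂ * ∑ꟳ (λ y → dev x y * dev x y) + + q * c₀
      row x = begin
        k * ∑ꟳ (λ y → dev x y * (dev x y * dev x y))
          ≡⟨ ∑-* (allFin q) k (λ y → dev x y * (dev x y * dev x y)) ⟨
        ∑ꟳ (λ y → k * (dev x y * (dev x y * dev x y)))
          ≤⟨ ∑-mono (allFin q) (bound x) ⟩
        ∑ꟳ (λ y → c₂ * (dev x y * dev x y) + (c₁ * dev x y + c₀))
          ≡⟨ trans (∑-+ (allFin q) (λ y → c₂ * (dev x y * dev x y)) (λ y → c₁ * dev x y + c₀))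
                   (cong₂ _+_ (∑-* (allFin q) c₂ (λ y → dev x y * dev x y)) (∑-+ (allFin q) (λ y → c₁ * dev x y) (λ _ → c₀))) ⟩
        c₂ * ∑ꟳ (λ y → dev x y * dev x y) + (∑ꟳ (λ y → c₁ * dev x y) + ∑ꟳ {q} (λ _ → c₀))
          ≡⟨ cong₂ (λ u v → c₂ * ∑ꟳ (λ y → dev x y * dev x y) + (u + v))
               (trans (∑-* (allFin q) c₁ (dev x)) (trans (cong (c₁ *_) (∑-dev x)) (ℤP.*-zeroʳ c₁)))
               (∑ꟳ-const {q} c₀) ⟩
        c₂ * ∑ꟳ (λ y → dev x y * dev x y) + (0ℤ + + q * c₀)
          ≡⟨ cong (λ z → c₂ * ∑ꟳ (λ y → dev x y * dev x y) + z) (ℤP.+-identityˡ (+ q * c₀)) ⟩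
        c₂ * ∑ꟳ (λ y → dev x y * dev x y) + + q * c₀ ∎

    ∑cubic : ℤ
    ∑cubic = ∑ S (λ f → degree f * ((degree f - s) * (degree f - s)))

    ∑cubic-≥ : ∀ l₁ l₀ →
      (∀ {f} → f ∈ₚ S → l₁ * (degree f - s) + l₀ ≤ degree f * ((degree f - s) * (degree f - s))) →
      l₁ * excess + s * l₀ ≤ ∑cubic
    ∑cubic-≥ l₁ l₀ bound = begin
      l₁ * excess + s * l₀
        ≡⟨ cong₂ _+_ (∑-* S l₁ (λ f → degree f - s)) (∑-const S l₀) ⟨
      ∑ S (λ f → l₁ * (degree f - s)) + ∑ S (λ _ → l₀)
        ≡⟨ ∑-+ S (λ f → l₁ * (degree f - s)) (λ _ → l₀) ⟨
      ∑ S (λ f → l₁ * (degree f - s) + l₀)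
        ≤⟨ ∑-mono-∈ S bound ⟩
      ∑cubic ∎
      where open ℤP.≤-Reasoning

    s[s-q]≤excess : s * (s - + q) ≤ excess
    s[s-q]≤excess = subst (_≤ excess) (∑-const S (s - + q)) (∑-mono-∈ S (λ {f} f∈ →
      ≤-by _ (ℤP.i≤j⇒0≤j-i (2s-q≤degree f∈)) (rearrange s (+ q) (degree f))))
      where
      rearrange : ∀ s q d → s - q + (d - (+ 2 * s - q)) ≡ d - s
      rearrange = solve-∀

    -- D (D - s) increases from D = 2s - q on, so it is replaced by its value (2s - q) (s - q)
    -- there. The other factor D - s is kept and sums to E.
    ∑cubic-≥-linear : 0ℤ ≤ s - + q → (+ 2 * s - + q) * (s - + q) * excess ≤ ∑cubic
    ∑cubic-≥-linear 0≤s-q = subst (_≤ ∑cubic) (pad ((+ 2 * s - + q) * (s - + q) * excess) s)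
      (∑cubic-≥ ((+ 2 * s - + q) * (s - + q)) 0ℤ pointwise)
      where
      pad : ∀ a s → a + s * 0ℤ ≡ a
      pad = solve-∀
      expand : ∀ s q d →
        (+ 2 * s - q) * (s - q) * (d - s) + 0ℤ
          + (s - q + (d - (+ 2 * s - q)))
            * ((d - (+ 2 * s - q)) * (s + (s - q)) + ((d - (+ 2 * s - q)) * (s - q) + (d - (+ 2 * s - q)) * (d - (+ 2 * s - q))))
        ≡ d * ((d - s) * (d - s))
      expand = solve-∀
      pointwise : ∀ {f} → f ∈ₚ S → (+ 2 * s - + q) * (s - + q) * (degree f - s) + 0ℤ ≤ degree f * ((degree f - s) * (degree f - s))
      pointwise {f} f∈ = ≤-by _
        (0≤* (0≤+ 0≤s-q 0≤u) (0≤+ (0≤* 0≤u (0≤+ (0≤+ₙ {length S}) 0≤s-q)) (0≤+ (0≤* 0≤u 0≤s-q) (0≤square u))))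
        (expand s (+ q) (degree f))
        where
        u : ℤ
        u = degree f - (+ 2 * s - + q)
        0≤u : 0ℤ ≤ u
        0≤u = ℤP.i≤j⇒0≤j-i (2s-q≤degree f∈)

    s≤q² : s ≤ + q * + q
    s≤q² = begin
      s                  ≡⟨ ∑-fibre-1 lead ⟨
      ∑ꟳ (fibre lead)    ≤⟨ ∑-mono (allFin q) sameLead≤q ⟩
      ∑ꟳ {q} (λ _ → + q) ≡⟨ ∑ꟳ-const {q} (+ q) ⟩
      + q * + q          ∎
      where open ℤP.≤-Reasoning

    -- With |S| = q² - 1 one fibre has q - 1 members and the others have q.
    ∑fibre² : ∀ κ → (∀ k → fibre κ k ≤ + q) → s + 1ℤ ≡ + q * + q →
      ∑ S (fibre κ ∘ κ) ≤ (+ 2 * + q - 1ℤ) * s + + q * - (+ q * (+ q - 1ℤ))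
    ∑fibre² κ F≤q s+1≡q² = begin
      ∑ S (fibre κ ∘ κ)
        ≡⟨ ∑-fibre κ (fibre κ) ⟨
      ∑ꟳ (λ k → fibre κ k * fibre κ k)
        ≤⟨ ∑-mono (allFin q) pointwise ⟩
      ∑ꟳ (λ k → (+ 2 * + q - 1ℤ) * fibre κ k + - (+ q * (+ q - 1ℤ)))
        ≡⟨ ∑-+ (allFin q) (λ k → (+ 2 * + q - 1ℤ) * fibre κ k) (λ _ → - (+ q * (+ q - 1ℤ))) ⟩
      ∑ꟳ (λ k → (+ 2 * + q - 1ℤ) * fibre κ k) + ∑ꟳ {q} (λ _ → - (+ q * (+ q - 1ℤ)))
        ≡⟨ cong₂ _+_ (trans (∑-* (allFin q) (+ 2 * + q - 1ℤ) (fibre κ)) (cong ((+ 2 * + q - 1ℤ) *_) (∑-fibre-1 κ)))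
                     (∑ꟳ-const {q} (- (+ q * (+ q - 1ℤ)))) ⟩
      (+ 2 * + q - 1ℤ) * s + + q * - (+ q * (+ q - 1ℤ)) ∎
      where
      open ℤP.≤-Reasoning
      -- The deficits q - `fibre κ k` are nonnegative and add up to q² - s = 1, so a single one is
      -- at most 1.
      deficiency : ∀ k → + q - fibre κ k ≤ 1ℤ
      deficiency k = begin
        + q - fibre κ k                          ≡⟨ ℤP.+-identityʳ (+ q - fibre κ k) ⟨
        ∑ (k ∷ []) (λ l → + q - fibre κ l)       ≤⟨ ∑-⊆ ([] ∷ []) (λ {l} _ → ∈-allFin l) (λ l → ℤP.i≤j⇒0≤j-i (F≤q l)) ⟩
        ∑ꟳ (λ l → + q - fibre κ l)               ≡⟨ ∑-cong (allFin q) (λ l → cong (λ z → + q + z) (sym (ℤP.-1*i≡-i (fibre κ l)))) ⟩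
        ∑ꟳ (λ l → + q + - 1ℤ * fibre κ l)        ≡⟨ ∑-+ (allFin q) (λ _ → + q) (λ l → - 1ℤ * fibre κ l) ⟩
        ∑ꟳ {q} (λ _ → + q) + ∑ꟳ (λ l → - 1ℤ * fibre κ l)
          ≡⟨ cong₂ _+_ (∑ꟳ-const {q} (+ q)) (trans (∑-* (allFin q) (- 1ℤ) (fibre κ)) (cong (- 1ℤ *_) (∑-fibre-1 κ))) ⟩
        + q * + q + - 1ℤ * s                     ≡⟨ cong (λ z → z + - 1ℤ * s) s+1≡q² ⟨
        s + 1ℤ + - 1ℤ * s                        ≡⟨ cancel s ⟩
        1ℤ                                       ∎
        where
        cancel : ∀ s → s + 1ℤ + - 1ℤ * s ≡ 1ℤ
        cancel = solve-∀
      pointwise : ∀ k → fibre κ k * fibre κ k ≤ (+ 2 * + q - 1ℤ) * fibre κ k + - (+ q * (+ q - 1ℤ))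
      pointwise k = ≤-by _ (0≤* (ℤP.i≤j⇒0≤j-i (F≤q k)) (ℤP.i≤j⇒0≤j-i (deficiency k))) (expand (+ q) (fibre κ k))
        where
        expand : ∀ q F → F * F + (q - F) * (1ℤ - (q - F)) ≡ (+ 2 * q - 1ℤ) * F + - (q * (q - 1ℤ))
        expand = solve-∀

    -- Sharper than `s[s-q]≤excess`: at q = 4 and s = 15 it improves the bound on E from 165 to 171.
    excess-≥ : s * (s + + q) - (∑ S (sameLead ∘ lead) + ∑ S (sameLin ∘ lin)) ≤ excess
    excess-≥ = begin
      s * (s + + q) - (∑ S (sameLead ∘ lead) + ∑ S (sameLin ∘ lin))
        ≡⟨ cong₂ (λ a b → a - b) (∑-const S (s + + q)) (∑-+ S (sameLead ∘ lead) (sameLin ∘ lin)) ⟨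
      ∑ S (λ _ → s + + q) - ∑ S (λ f → sameLead (lead f) + sameLin (lin f))
        ≡⟨ cong (λ z → ∑ S (λ _ → s + + q) + z) (trans (sym (ℤP.-1*i≡-i _)) (sym (∑-* S (- 1ℤ) (λ f → sameLead (lead f) + sameLin (lin f))))) ⟩
      ∑ S (λ _ → s + + q) + ∑ S (λ f → - 1ℤ * (sameLead (lead f) + sameLin (lin f)))
        ≡⟨ ∑-+ S (λ _ → s + + q) (λ f → - 1ℤ * (sameLead (lead f) + sameLin (lin f))) ⟨
      ∑ S (λ f → s + + q + - 1ℤ * (sameLead (lead f) + sameLin (lin f)))
        ≤⟨ ∑-mono-∈ S (λ {f} f∈ → ≤-by _ (ℤP.i≤j⇒0≤j-i (degree-≥ f∈))
             (rearrange s (+ q) (degree f) (sameLead (lead f) + sameLin (lin f)))) ⟩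
      excess ∎
      where
      open ℤP.≤-Reasoning
      rearrange : ∀ s q d c → s + q + - 1ℤ * c + (d + c - (+ 2 * s + q)) ≡ d - s
      rearrange = solve-∀

    -- Contradictions when every point is missed by some member.

    module _ (missed : ∀ x y → ∃[ f ] (f ∈ₚ S × value x f ≢ y)) where

      through-≤ : ∀ x y → + 2 * through x y + + 2 ≤ + q * + q + + q
      through-≤ x y = let f , f∈ , f∌ = missed x y in through-missed f∈ f∌

      8≤q-impossible : + 8 ≤ + q → 0ℤ ≤ + 32 * s - (+ 30 * (+ q * + q) - + 3 * + q + + 4) → ⊥
      8≤q-impossible 8≤q large = 8≤q-contradiction (+ q) s ∑cubic ∑dev³ excess 8≤q large
        s[s-q]≤excess ∑cubic-≥-linear T≤ third-moment
        where
        -- Twice the largest deviation that `through-≤` permits, attained for n = (q - 1) (q + 2) /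
        -- 2; hence 2 dev ≤ c, and multiplying by dev² gives the estimate.
        c : ℤ
        c = + q * (+ q * + q + + q - + 2) - + 2 * s
        T≤ : + 2 * ∑dev³ ≤ c * (+ q * (+ q * excess))
        T≤ = subst (+ 2 * ∑dev³ ≤_) (pad (c * (+ q * (+ q * excess))) (+ q)) (∑dev³-≤ (+ 2) c 0ℤ 0ℤ pointwise)
          where
          pad : ∀ a q → a + q * (q * 0ℤ) ≡ a
          pad = solve-∀
          pointwise : ∀ x y → + 2 * (dev x y * (dev x y * dev x y)) ≤ c * (dev x y * dev x y) + (0ℤ * dev x y + 0ℤ)
          pointwise x y = ≤-by _ (0≤* (0≤* (0≤+ₙ {q}) (ℤP.i≤j⇒0≤j-i (through-≤ x y))) (0≤square (dev x y)))
            (expand (+ q) s (through x y))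
            where
            expand : ∀ q s n →
              + 2 * ((q * n - s) * ((q * n - s) * (q * n - s))) + q * (q * q + q - (+ 2 * n + + 2)) * ((q * n - s) * (q * n - s))
              ≡ (q * (q * q + q - + 2) - + 2 * s) * ((q * n - s) * (q * n - s)) + (0ℤ * (q * n - s) + 0ℤ)
            expand = solve-∀

      16-impossible : + q ≡ + 4 → s ≡ + 16 → ⊥
      16-impossible q≡4 s≡16 = 16-contradiction (+ q) s ∑cubic ∑dev³ excess q≡4 s≡16
        s[s-q]≤excess (∑cubic-≥-linear (0≤s-q q≡4 s≡16)) T≤ third-moment
        where
        0≤s-q : ∀ {q s} → q ≡ + 4 → s ≡ + 16 → 0ℤ ≤ s - q
        0≤s-q refl refl = 0≤+ₙ
        -- From (n - 1)(n - 2)(n - 9) ≤ 0, valid for every integer n ≤ 9.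
        pointwise : ∀ {q s} n → q ≡ + 4 → s ≡ + 16 → + 2 * n + + 2 ≤ q * q + q → let d = q * n - s in
          1ℤ * (d * (d * d)) ≤ 0ℤ * (d * d) + (+ 304 * d + + 1920)
        pointwise n refl refl n≤ = ≤-by _
          (0≤* (0≤* (0≤+ₙ {32}) (0≤i[i-1] (n - 1ℤ))) (ℤP.i≤j⇒0≤j-i n≤)) (expand n)
          where
          expand : ∀ n → 1ℤ * ((+ 4 * n - + 16) * ((+ 4 * n - + 16) * (+ 4 * n - + 16)))
              + + 32 * ((n - 1ℤ) * (n - 1ℤ - 1ℤ)) * (+ 20 - (+ 2 * n + + 2))
            ≡ 0ℤ * ((+ 4 * n - + 16) * (+ 4 * n - + 16)) + (+ 304 * (+ 4 * n - + 16) + + 1920)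
          expand = solve-∀
        T≤ : ∑dev³ ≤ + q * (+ q * + 1920)
        T≤ = subst₂ _≤_ (ℤP.*-identityˡ ∑dev³) (drop0 (+ q * (+ q * excess)) (+ q * (+ q * + 1920)))
          (∑dev³-≤ 1ℤ 0ℤ (+ 304) (+ 1920) (λ x y → pointwise (through x y) q≡4 s≡16 (through-≤ x y)))
          where
          drop0 : ∀ a b → 0ℤ * a + b ≡ b
          drop0 = solve-∀

      15-impossible : + q ≡ + 4 → s ≡ + 15 → ⊥
      15-impossible q≡4 s≡15 = 15-contradiction (+ q) s ∑cubic ∑dev³ excess q≡4 s≡15 E≥
        (∑cubic-≥ (+ 742) (- + 5016) (λ {f} f∈ → cubic≥ (degree f) q≡4 s≡15 (2s-q≤degree f∈))) T≤ third-moment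
        where
        s+1≡q² : ∀ {q s} → q ≡ + 4 → s ≡ + 15 → s + 1ℤ ≡ q * q
        s+1≡q² refl refl = refl
        combine : ∀ {q s A B E} → q ≡ + 4 → s ≡ + 15 →
          A ≤ (+ 2 * q - 1ℤ) * s + q * - (q * (q - 1ℤ)) → B ≤ (+ 2 * q - 1ℤ) * s + q * - (q * (q - 1ℤ)) →
          s * (s + q) - (A + B) ≤ E → + 171 ≤ E
        combine {A = A} {B} {E} refl refl A≤ B≤ E≥ = ≤-by _
          (0≤+ (ℤP.i≤j⇒0≤j-i A≤) (0≤+ (ℤP.i≤j⇒0≤j-i B≤) (ℤP.i≤j⇒0≤j-i E≥))) (rearrange A B E)
          where
          -- Here 57 = 3 · 4² + 3² bounds each sum of class sizes, 285 = 15 · 19 is s (s + q), and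
          -- 171 = 285 - 2 · 57.
          rearrange : ∀ A B E → + 171 + (+ 57 - A + (+ 57 - B + (E - (+ 285 - (A + B))))) ≡ E
          rearrange = solve-∀
        E≥ : + 171 ≤ excess
        E≥ = combine q≡4 s≡15 (∑fibre² lead sameLead≤q (s+1≡q² q≡4 s≡15)) (∑fibre² lin sameLin≤q (s+1≡q² q≡4 s≡15)) excess-≥
        -- The chord of the cubic through the consecutive integers 26 and 27.
        cubic≥ : ∀ {q s} d → q ≡ + 4 → s ≡ + 15 → + 2 * s - q ≤ d →
          + 742 * (d - s) + - + 5016 ≤ d * ((d - s) * (d - s))
        cubic≥ d refl refl d≥ = ≤-by _
          (0≤* (0≤i[i-1] (d - + 26)) (0≤+ (ℤP.i≤j⇒0≤j-i d≥) (0≤+ₙ {49}))) (expand d)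
          where
          expand : ∀ d → + 742 * (d - + 15) + - + 5016 + (d - + 26) * (d - + 26 - 1ℤ) * (d - + 26 + + 49)
            ≡ d * ((d - + 15) * (d - + 15))
          expand = solve-∀
        -- From (n - 1)(n - 2)(n - 9) ≤ 0, valid for every integer n ≤ 9.
        pointwise : ∀ {q s} n → q ≡ + 4 → s ≡ + 15 → + 2 * n + + 2 ≤ q * q + q → let d = q * n - s in
          1ℤ * (d * (d * d)) ≤ + 3 * (d * d) + (+ 301 * d + + 1617)
        pointwise n refl refl n≤ = ≤-by _
          (0≤* (0≤* (0≤+ₙ {32}) (0≤i[i-1] (n - 1ℤ))) (ℤP.i≤j⇒0≤j-i n≤)) (expand n)
          where
          expand : ∀ n → 1ℤ * ((+ 4 * n - + 15) * ((+ 4 * n - + 15) * (+ 4 * n - + 15)))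
              + + 32 * ((n - 1ℤ) * (n - 1ℤ - 1ℤ)) * (+ 20 - (+ 2 * n + + 2))
            ≡ + 3 * ((+ 4 * n - + 15) * (+ 4 * n - + 15)) + (+ 301 * (+ 4 * n - + 15) + + 1617)
          expand = solve-∀
        T≤ : ∑dev³ ≤ + 3 * (+ q * (+ q * excess)) + + q * (+ q * + 1617)
        T≤ = subst (_≤ + 3 * (+ q * (+ q * excess)) + + q * (+ q * + 1617)) (ℤP.*-identityˡ ∑dev³)
          (∑dev³-≤ 1ℤ (+ 3) (+ 301) (+ 1617) (λ x y → pointwise (through x y) q≡4 s≡15 (through-≤ x y)))

    -- A search over the q² points decides whether a common one exists; a failed search supplies,
    -- for each point, an explicit member missing it.
    common-point : + q ≡ + 4 ⊎ + 8 ≤ + q → 0ℤ ≤ + 32 * s - (+ 30 * (+ q * + q) - + 3 * + q + + 4) →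
      ∃[ x ] ∃[ y ] (∀ {f} → f ∈ₚ S → value x f ≡ y)
    common-point size large with any? (λ x → any? (λ y → All.all? (λ f → value x f ≟ y) S))
    ... | yes (x , y , all) = x , y , All.lookup all
    ... | no none = ⊥-elim (impossible size)
      where
      missed : ∀ x y → ∃[ f ] (f ∈ₚ S × value x f ≢ y)
      missed x y = find (¬All⇒Any¬ (λ f → value x f ≟ y) S (λ all → none (x , y , all)))
      impossible : + q ≡ + 4 ⊎ + 8 ≤ + q → ⊥
      impossible (inj₂ 8≤q) = 8≤q-impossible missed 8≤q large
      impossible (inj₁ q≡4) with 15⊎16 q≡4 large s≤q²
      ... | inj₁ s≡15 = 15-impossible missed q≡4 s≡15
      ... | inj₂ s≡16 = 16-impossible missed q≡4 s≡16

-- The characteristic, and the hypothesis on ε in integers.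

-- If 1 + 1 ≠ 0 then negation pairs off the nonzero elements, so q is odd.
even⇒1⊕1≡0 : ∀ {q k} {_⊕_ _⊗_ : Op₂ (Fin q)} {⊖_ : Op₁ (Fin q)} {0K 1K : Fin q} →
  IsCommutativeRing _≡_ _⊕_ _⊗_ ⊖_ 0K 1K → (∀ x → x ≢ 0K → ∃[ y ] y ⊗ x ≡ 1K) →
  q ≡ 2 ℕ.* k → 1K ⊕ 1K ≡ 0K
even⇒1⊕1≡0 {q} {k} {_⊕_} {_⊗_} {⊖_} {0K} {1K} isCommutativeRing inverse q≡2k with (1K ⊕ 1K) ≟ 0K
... | yes eq = eq
... | no 2≢0 = contradiction (trans (sym q≡2k) (ℤP.+-injective odd)) (ℕP.even≢odd k ∣ N ∣)
  where
  ring : CommutativeRing _ _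
  ring = record { isCommutativeRing = isCommutativeRing }
  open IsCommutativeRing isCommutativeRing
    using (*-identityˡ; zeroʳ; *-assoc; -‿inverseʳ; distribʳ)
  open RingProperties (CommutativeRing.ring ring) using (-0#≈0#; -‿involutive)

  fixed⇒0 : ∀ x → x ≡ ⊖ x → x ≡ 0K
  fixed⇒0 x x≡⊖x = let h , h2≡1 = inverse (1K ⊕ 1K) 2≢0 in begin
    x                      ≡⟨ *-identityˡ x ⟨
    1K ⊗ x                 ≡⟨ cong (_⊗ x) h2≡1 ⟨
    (h ⊗ (1K ⊕ 1K)) ⊗ x    ≡⟨ *-assoc h (1K ⊕ 1K) x ⟩
    h ⊗ ((1K ⊕ 1K) ⊗ x)    ≡⟨ cong (h ⊗_) (distribʳ x 1K 1K) ⟩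
    h ⊗ ((1K ⊗ x) ⊕ (1K ⊗ x)) ≡⟨ cong₂ (λ y z → h ⊗ (y ⊕ z)) (*-identityˡ x) (trans (*-identityˡ x) x≡⊖x) ⟩
    h ⊗ (x ⊕ (⊖ x))        ≡⟨ cong (h ⊗_) (-‿inverseʳ x) ⟩
    h ⊗ 0K                 ≡⟨ zeroʳ h ⟩
    0K                     ∎
    where open ≡-Reasoning

  below : Fin q → ℤ
  below x = 𝟙 (x Fin.<? ⊖ x)
  N : ℤ
  N = ∑ꟳ below

  -- Exactly one of x < -x, x = 0 and -x < x holds. The last is written as `below (⊖ x)`, so that
  -- reindexing by negation yields N a second time.
  split : ∀ x → 1ℤ ≡ below x + (𝟙 (0K ≟ x) + below (⊖ x))
  split x with FinP.<-cmp x (⊖ x)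
  ... | tri< lt ≢ ≯ = sym (cong₂ _+_ (𝟙-yes (x Fin.<? ⊖ x) lt) (cong₂ _+_
          (𝟙-no (0K ≟ x) (λ { refl → ≢ (sym -0#≈0#) }))
          (𝟙-no (⊖ x Fin.<? ⊖ (⊖ x)) (≯ ∘ subst ((⊖ x) Fin.<_) (-‿involutive x)))))
  ... | tri≈ ≮ eq ≯ = sym (cong₂ _+_ (𝟙-no (x Fin.<? ⊖ x) ≮) (cong₂ _+_
          (𝟙-yes (0K ≟ x) (sym (fixed⇒0 x eq)))
          (𝟙-no (⊖ x Fin.<? ⊖ (⊖ x)) (≯ ∘ subst ((⊖ x) Fin.<_) (-‿involutive x)))))
  ... | tri> ≮ ≢ gt = sym (cong₂ _+_ (𝟙-no (x Fin.<? ⊖ x) ≮) (cong₂ _+_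
          (𝟙-no (0K ≟ x) (λ { refl → ≢ (sym -0#≈0#) }))
          (𝟙-yes (⊖ x Fin.<? ⊖ (⊖ x)) (subst ((⊖ x) Fin.<_) (sym (-‿involutive x)) gt))))

  0≤N : 0ℤ ≤ N
  0≤N = ∑-nonneg (allFin q) (λ x → 0≤𝟙 (x Fin.<? ⊖ x))

  odd : + q ≡ + ℕ.suc (2 ℕ.* ∣ N ∣)
  odd = begin
    + q                                                      ≡⟨ ℤP.*-identityʳ (+ q) ⟨
    + q * 1ℤ                                                 ≡⟨ ∑ꟳ-const {q} 1ℤ ⟨
    ∑ꟳ {q} (λ _ → 1ℤ)                                        ≡⟨ ∑-cong (allFin q) split ⟩
    ∑ꟳ (λ x → below x + (𝟙 (0K ≟ x) + below (⊖ x)))          ≡⟨ ∑-+ (allFin q) below (λ x → 𝟙 (0K ≟ x) + below (⊖ x)) ⟩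
    N + ∑ꟳ (λ x → 𝟙 (0K ≟ x) + below (⊖ x))                  ≡⟨ cong (λ z → N + z) (∑-+ (allFin q) (λ x → 𝟙 (0K ≟ x)) (below ∘ ⊖_)) ⟩
    N + (∑ꟳ (λ x → 𝟙 (0K ≟ x)) + ∑ꟳ (below ∘ ⊖_))            ≡⟨ cong₂ (λ y z → N + (y + z)) (∑ꟳ-𝟙 0K) (∑ꟳ-reindex -‿involutive -‿involutive below) ⟩
    N + (1ℤ + N)                                             ≡⟨ collect N ⟩
    1ℤ + + 2 * N                                             ≡⟨ cong (λ z → 1ℤ + + 2 * z) (ℤP.0≤i⇒+∣i∣≡i 0≤N) ⟨
    1ℤ + + 2 * + ∣ N ∣                                       ≡⟨ cong (λ z → 1ℤ + z) (ℤP.pos-* 2 ∣ N ∣) ⟨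
    + ℕ.suc (2 ℕ.* ∣ N ∣)                                    ∎
    where
    open ≡-Reasoning
    collect : ∀ N → N + (1ℤ + N) ≡ 1ℤ + + 2 * N
    collect = solve-∀

-- √q ≤ q / 4 + 1 turns the hypothesis into 32 ε < (2 q - 1) (q + 4) - 4 q.
32ε-bound : ∀ {q ε} → 2 ℕ.< q → BelowBound q ε → + 32 * ε ℤ.< + 2 * (+ q * + q) + + 3 * + q - + 4
32ε-bound {q} {ε} 2<q (mkℚᵘ p d-1 , _ , *≤* r²≤q , *<* ε<) =
  ℤP.*-cancelˡ-<-nonNeg (+ 8 * (D * D)) {{nonNegative (0≤* (0≤+ₙ {8}) (0≤square D))}} (begin-strict
    + 8 * (D * D) * (+ 32 * ε)
      ≡⟨ trans (regroup ε D) (sym (cong (ε *_) denominator)) ⟩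
    -- The rational inequality is available only cross-multiplied, with the unreduced denominators
    -- that the operations on unnormalised rationals produce.
    ε * + (((1 ℕ.* d) ℕ.* 4) ℕ.* 8 ℕ.* (d ℕ.* 8))
      <⟨ ε< ⟩
    ((((+ q * p) * 1ℤ) * + 8 + (- + q) * + ((1 ℕ.* d) ℕ.* 4)) * + (d ℕ.* 8) + (- (p * 1ℤ)) * + (((1 ℕ.* d) ℕ.* 4) ℕ.* 8)) * 1ℤ
      ≡⟨ cong (_* 1ℤ) (cong₂ _+_ (cong₂ _*_ (cong (λ z → ((+ q * p) * 1ℤ) * + 8 + (- + q) * z) 4d) (ℤP.pos-* d 8))
                                 (cong ((- (p * 1ℤ)) *_) 32d)) ⟩
    ((((+ q * p) * 1ℤ) * + 8 + (- + q) * (D * + 4)) * (D * + 8) + (- (p * 1ℤ)) * (D * + 4 * + 8)) * 1ℤ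
      -- With r = p / D the square (p - 2D)² says 4r ≤ r² + 4 ≤ q + 4. The factor 2q - 1 is the
      -- coefficient of r in the bound, (2q - 1) / 8, without its denominator.
      ≤⟨ ≤-by _ (0≤* (0≤* (0≤+ₙ {8}) 0≤2q-1) (0≤+ (ℤP.i≤j⇒0≤j-i p²≤qD²) (0≤square (p - + 2 * D)))) (expand (+ q) p D) ⟩
    + 8 * (D * D) * (+ 2 * (+ q * + q) + + 3 * + q - + 4) ∎)
  where
  open ℤP.≤-Reasoning
  d : ℕ
  d = ℕ.suc d-1
  D : ℤ
  D = + d
  4d : + ((1 ℕ.* d) ℕ.* 4) ≡ D * + 4
  4d = trans (ℤP.pos-* (1 ℕ.* d) 4) (cong (λ n → + n * + 4) (ℕP.*-identityˡ d))
  32d : + (((1 ℕ.* d) ℕ.* 4) ℕ.* 8) ≡ D * + 4 * + 8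
  32d = trans (ℤP.pos-* ((1 ℕ.* d) ℕ.* 4) 8) (cong (_* + 8) 4d)
  denominator : + (((1 ℕ.* d) ℕ.* 4) ℕ.* 8 ℕ.* (d ℕ.* 8)) ≡ D * + 4 * + 8 * (D * + 8)
  denominator = trans (ℤP.pos-* (((1 ℕ.* d) ℕ.* 4) ℕ.* 8) (d ℕ.* 8)) (cong₂ _*_ 32d (ℤP.pos-* d 8))
  regroup : ∀ ε D → + 8 * (D * D) * (+ 32 * ε) ≡ ε * (D * + 4 * + 8 * (D * + 8))
  regroup = solve-∀
  p²≤qD² : p * p ≤ + q * (D * D)
  p²≤qD² = subst₂ _≤_ (ℤP.*-identityʳ (p * p)) (cong (+ q *_) (ℤP.pos-* d d)) r²≤q
  0≤2q-1 : 0ℤ ≤ + 2 * + q - 1ℤ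
  0≤2q-1 = ≤-by _ (0≤+ (0≤* (0≤+ₙ {2}) (ℤP.i≤j⇒0≤j-i (+≤+ 2<q))) (0≤+ₙ {5})) (shift (+ q))
    where
    shift : ∀ q → 0ℤ + (+ 2 * (q - + 3) + + 5) ≡ + 2 * q - 1ℤ
    shift = solve-∀
  expand : ∀ q p D →
    (((q * p) * 1ℤ * + 8 + (- q) * (D * + 4)) * (D * + 8) + (- (p * 1ℤ)) * (D * + 4 * + 8)) * 1ℤ
      + + 8 * (+ 2 * q - 1ℤ) * (q * (D * D) - p * p + (p - + 2 * D) * (p - + 2 * D))
    ≡ + 8 * (D * D) * (+ 2 * (q * q) + + 3 * q - + 4)
  expand = solve-∀

-- Transport from the Heyting field to `Fin q`, where equality is propositional and decidable.

module Transport {c ℓ₁ ℓ₂} (F : HeytingField c ℓ₁ ℓ₂) {q : ℕ} (enumeration : HasCardinality F q) where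

  private module F = HeytingField F
  open Inverse enumeration using (to; from; to-cong; from-cong; strictlyInverseˡ; strictlyInverseʳ)

  to-injective : ∀ {x y} → to x ≡ to y → x F.≈ y
  to-injective {x} {y} eq = F.trans (F.sym (strictlyInverseʳ x)) (F.trans (from-cong eq) (strictlyInverseʳ y))

  from-injective : ∀ {i j} → from i F.≈ from j → i ≡ j
  from-injective {i} {j} eq = trans (sym (strictlyInverseˡ i)) (trans (to-cong eq) (strictlyInverseˡ j))

  _⊕_ _⊗_ : Op₂ (Fin q)
  i ⊕ j = to (from i F.+ from j)
  i ⊗ j = to (from i F.* from j)

  ⊖_ : Op₁ (Fin q)
  ⊖ i = to (F.- from i)

  0K 1K : Fin q
  0K = to F.0#
  1K = to F.1#

  from-isRingMonomorphism : IsRingMonomorphism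
    (record { Carrier = Fin q ; _≈_ = _≡_ ; _+_ = _⊕_ ; _*_ = _⊗_ ; -_ = ⊖_ ; 0# = 0K ; 1# = 1K })
    (record { Carrier = F.Carrier ; _≈_ = F._≈_ ; _+_ = F._+_ ; _*_ = F._*_ ; -_ = F.-_ ; 0# = F.0# ; 1# = F.1# })
    from
  from-isRingMonomorphism = record
    { isRingHomomorphism = record
      { isSemiringHomomorphism = record
        { isNearSemiringHomomorphism = record
          { +-isMonoidHomomorphism = record
            { isMagmaHomomorphism = record
              { isRelHomomorphism = record { cong = from-cong }
              ; homo = λ i j → strictlyInverseʳ (from i F.+ from j)
              }
            ; ε-homo = strictlyInverseʳ F.0#
            }
          ; *-homo = λ i j → strictlyInverseʳ (from i F.* from j)
          }
        ; 1#-homo = strictlyInverseʳ F.1#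
        }
      ; -‿homo = λ i → strictlyInverseʳ (F.- from i)
      }
    ; injective = from-injective
    }

  isCommutativeRing : IsCommutativeRing _≡_ _⊕_ _⊗_ ⊖_ 0K 1K
  isCommutativeRing = RingMonomorphism.isCommutativeRing from-isRingMonomorphism F.isCommutativeRing

  -- Tightness only yields that an inverse cannot fail to exist; finiteness makes
  -- its existence decidable.
  inverse : ∀ i → i ≢ 0K → ∃[ j ] j ⊗ i ≡ 1K
  inverse i i≢0 with any? (λ j → (j ⊗ i) ≟ 1K)
  ... | yes found = found
  ... | no none = contradiction (from-injective (F.trans i≈0 (F.sym (strictlyInverseʳ F.0#)))) i≢0
    where
    i≈0 : from i F.≈ F.0#
    i≈0 = proj₁ (F.tight (from i) F.0#) λ i#0 →
      let y , y[i-0]≈1 , _ = F.#⇒invertible i#0 in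
      none (to y , to-cong (F.trans
        (F.*-cong (strictlyInverseʳ y) (F.sym (F.trans (F.+-congˡ (RingProperties.-0#≈0# (CommutativeRing.ring commutativeRing))) (F.+-identityʳ (from i)))))
        y[i-0]≈1))
      where
      commutativeRing : CommutativeRing c ℓ₁
      commutativeRing = record { isCommutativeRing = F.isCommutativeRing }

  module _ (k : ℕ) (q≡2k : q ≡ 2 ℕ.* k) where

    open Polynomials F
    private
      1⊕1≡0 : 1K ⊕ 1K ≡ 0K
      1⊕1≡0 = even⇒1⊕1≡0 {k = k} isCommutativeRing inverse q≡2k
    open IntersectingFamily isCommutativeRing 1⊕1≡0 inverse
    private module Poly≤2 = Setoid (poly≤-setoid 2)

    encode : Poly≤ 2 → Quadratic
    encode (c ∷ b ∷ a ∷ []) = to a , to b , to c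

    encode-injective : ∀ {f g} → encode f ≡ encode g → f Poly≤2.≈ g
    encode-injective {_ ∷ _ ∷ _ ∷ []} {_ ∷ _ ∷ _ ∷ []} eq =
      to-injective (cong (proj₂ ∘ proj₂) eq) ∷ to-injective (cong (proj₁ ∘ proj₂) eq) ∷ to-injective (cong proj₁ eq) ∷ []

    encode-cong : ∀ {f g} → f Poly≤2.≈ g → encode f ≡ encode g
    encode-cong {_ ∷ _ ∷ _ ∷ []} {_ ∷ _ ∷ _ ∷ []} (c ∷ b ∷ a ∷ []) =
      cong₂ _,_ (to-cong a) (cong₂ _,_ (to-cong b) (to-cong c))

    -- Beyond undoing `from` after `to`, the one difference is that `eval` ends in a + x * 0,
    -- whereas `value` stops at the leading coefficient.
    value-encode : ∀ i f → value i (encode f) ≡ to (eval f (from i))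
    value-encode i (c ∷ b ∷ a ∷ []) = to-cong
      (F.+-cong (strictlyInverseʳ c) (F.trans (strictlyInverseʳ _) (F.*-congˡ (F.trans (strictlyInverseʳ _)
        (F.+-cong (strictlyInverseʳ b) (F.trans (strictlyInverseʳ _) (F.*-congˡ (F.trans (strictlyInverseʳ a)
          (F.sym (F.trans (F.+-congˡ (F.zeroʳ (from i))) (F.+-identityʳ a)))))))))))

    eval-cong : ∀ {n} (f : Vec F.Carrier n) {x y} → x F.≈ y → eval f x F.≈ eval f y
    eval-cong []      x≈y = F.refl
    eval-cong (a ∷ f) x≈y = F.+-congˡ (F.*-cong x≈y (eval-cong f x≈y))

    value-encode-to : ∀ x f → value (to x) (encode f) ≡ to (eval f x)
    value-encode-to x f = trans (value-encode (to x) f) (to-cong (eval-cong f (strictlyInverseʳ x)))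

    graphs-share-common-point : (U : List (Poly≤ 2)) → Unique U → Intersecting U →
      + q ≡ + 4 ⊎ + 8 ≤ + q → 0ℤ ≤ + 32 * + length U - (+ 30 * (+ q * + q) - + 3 * + q + + 4) →
      GraphsShareCommonPoint U
    graphs-share-common-point U U! meet size large =
      let i , j , agree = common-point S! S-meet size
            (subst (λ n → 0ℤ ≤ + 32 * + n - (+ 30 * (+ q * + q) - + 3 * + q + + 4)) (sym (length-map encode U)) large)
      in (from i , from j) , λ {f} f∈ → to-injective (begin
        to (from j)             ≡⟨ strictlyInverseˡ j ⟩
        j                       ≡⟨ agree (∈-map⁺ (poly≤-setoid 2) (setoid Quadratic) encode-cong f∈) ⟨
        value i (encode f)      ≡⟨ value-encode i f ⟩
        to (eval f (from i))    ∎)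
      where
      open ≡-Reasoning
      S : List Quadratic
      S = map encode U
      S! : Uniqueₚ S
      S! = map⁺ (poly≤-setoid 2) (setoid Quadratic) encode-injective U!
      S-meet : ∀ {f h} → f ∈ₚ S → h ∈ₚ S → ∃[ x ] value x f ≡ value x h
      S-meet f∈ h∈ with ∈-map⁻ (poly≤-setoid 2) (setoid Quadratic) f∈ | ∈-map⁻ (poly≤-setoid 2) (setoid Quadratic) h∈
      ... | f , f∈U , refl | h , h∈U , refl with meet f∈U h∈U
      ...   | (x , y) , y≈fx , y≈hx = to x ,
              trans (value-encode-to x f) (trans (to-cong (F.trans (F.sym y≈fx) y≈hx)) (sym (value-encode-to x h)))

4⊎8≤ : ∀ {q} h → q ≡ 2 ^ h → 2 ℕ.< q → + q ≡ + 4 ⊎ + 8 ≤ + q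
4⊎8≤ 0 refl (ℕ.s≤s ())
4⊎8≤ 1 refl (ℕ.s≤s (ℕ.s≤s ()))
4⊎8≤ 2 refl _ = inj₁ refl
4⊎8≤ (ℕ.suc (ℕ.suc (ℕ.suc h))) refl _ = inj₂ (+≤+ (ℕP.^-monoʳ-≤ 2 (ℕP.m≤m+n 3 h)))

even : ∀ {q} h → q ≡ 2 ^ h → 2 ℕ.< q → ∃[ k ] q ≡ 2 ℕ.* k
even 0          refl (ℕ.s≤s ())
even (ℕ.suc h)  q≡   _ = 2 ^ h , q≡

theorem5 : ∀ {c ℓ₁ ℓ₂} (F : HeytingField c ℓ₁ ℓ₂) (q : ℕ) →
    let open Polynomials F in
    HasCardinality F q →
    (∃[ h ] (q ≡ 2 ^ h)) →
    2 < q →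
    (U : List (Poly≤ 2)) → Unique U →
    Intersecting U →
    (ε : ℤ) → + length U ≡ + (q ^ 2) - ε →
    BelowBound q ε →
    GraphsShareCommonPoint U
theorem5 F q enumeration (h , q≡2^h) 2<q U U! meet ε |U|≡ below =
  Transport.graphs-share-common-point F enumeration (proj₁ 2∣q) (proj₂ 2∣q) U U! meet (4⊎8≤ h q≡2^h 2<q)
    (subst (0ℤ ≤_) rearranged (ℤP.i≤j⇒0≤j-i (ℤP.<⇒≤ (32ε-bound 2<q below))))
  where
  open ≡-Reasoning
  2∣q : ∃[ k ] q ≡ 2 ℕ.* k
  2∣q = even h q≡2^h 2<q
  regroup : ∀ q ε → + 2 * (q * q) + + 3 * q - + 4 - + 32 * ε ≡ + 32 * (q * q - ε) - (+ 30 * (q * q) - + 3 * q + + 4)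
  regroup = solve-∀
  q² : + (q ^ 2) ≡ + q * + q
  q² = trans (cong (λ n → + (q ℕ.* n)) (ℕP.*-identityʳ q)) (ℤP.pos-* q q)
  rearranged : + 2 * (+ q * + q) + + 3 * + q - + 4 - + 32 * ε ≡ + 32 * + length U - (+ 30 * (+ q * + q) - + 3 * + q + + 4)
  rearranged = begin
    + 2 * (+ q * + q) + + 3 * + q - + 4 - + 32 * ε
      ≡⟨ regroup (+ q) ε ⟩
    + 32 * (+ q * + q - ε) - (+ 30 * (+ q * + q) - + 3 * + q + + 4)
      ≡⟨ cong (λ n → + 32 * n - (+ 30 * (+ q * + q) - + 3 * + q + + 4)) (trans |U|≡ (cong (_- ε) q²)) ⟨
    + 32 * + length U - (+ 30 * (+ q * + q) - + 3 * + q + + 4) ∎
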